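{- Let $\Pi'$ be a polar space of rank $l\ge 3$ and $\Pi$ a polar space of rank $n$, and let $k\le n-2$. If $f$ is a $3$-embedding of the dual polar graph $\Gamma_{l-1}(\Pi')$ in the polar Grassmann graph $\Gamma_k(\Pi)$, then $k\le n-4$ and there is a singular subspace $U$ of $\Pi$ such that the image of $f$ is contained in $\langle U]_k$.
   Context: Polar space: a partial linear space (points and lines, each line with at least two points, two distinct points on at most one line; collinear points written $p\perp q$) in which every line has at least three points, no point is collinear with all points, every point is collinear with one or all points of any line, and chains of distinct incident singular subspaces (subspaces in which any two points are collinear; a subspace contains the line through any two of its collinear points) are finite. Singular subspaces are projective spaces; dimension is projective dimension (empty set: $-1$); rank $n$ means maximal singular subspaces have dimension $n-1$. $\mathcal G_k(\Pi)$ is the set of $k$-dimensional singular subspaces. For $k\le n-2$, $\Gamma_k(\Pi)$ is the graph on $\mathcal G_k(\Pi)$ in which distinct vertices are adjacent iff some $(k+1)$-dimensional singular subspace contains both. The dual polar graph $\Gamma_{l-1}(\Pi')$ has as vertices the maximal singular subspaces of $\Pi'$, two being adjacent iff their intersection is $(l-2)$-dimensional. $\langle U]_k$ denotes the set of elements of $\mathcal G_k(\Pi)$ contained in $U$. An embedding of a graph in another is an injection of vertex sets preserving adjacency and non-adjacency; it is a $3$-embedding if it preserves every graph distance not greater than $3$. -}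

module Defs where

open import Level using (Level; _⊔_) renaming (zero to lzero; suc to lsuc)
open import Data.Nat using (ℕ; zero; suc; _≤_; _<_)
open import Data.Product using (Σ; Σ-syntax; ∃; _×_; _,_)
open import Data.Sum using (_⊎_)
open import Data.Empty using (⊥)
open import Relation.Nullary using (¬_)
open import Relation.Binary.PropositionalEquality using (_≡_)

record Geometry : Set₁ where
  field
    Point : Set
    Line  : Set
    _I_   : Point → Line → Set

  _⟂_ : Point → Point → Set
  p ⟂ q = (p ≡ q) ⊎ (Σ[ L ∈ Line ] (p I L × q I L))

  PSet : Set₁
  PSet = Point → Set

  _⊆_ : PSet → PSet → Set
  A ⊆ B = ∀ p → A p → B p

  _≐_ : PSet → PSet → Set
  A ≐ B = (A ⊆ B) × (B ⊆ A)

  _⊂_ : PSet → PSet → Set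
  A ⊂ B = (A ⊆ B) × (Σ[ p ∈ Point ] (B p × ¬ A p))

  _∩_ : PSet → PSet → PSet
  (A ∩ B) p = A p × B p

  ∅ : PSet
  ∅ p = ⊥

  IsSubspace : PSet → Set
  IsSubspace S = ∀ (p q : Point) (L : Line) → ¬ (p ≡ q) → S p → S q →
                 p I L → q I L → ∀ r → r I L → S r

  IsSingular : PSet → Set
  IsSingular S = ∀ p q → S p → S q → p ⟂ q

  IsSingularSubspace : PSet → Set
  IsSingularSubspace S = IsSubspace S × IsSingular S

  IsChainIn : PSet → ℕ → (ℕ → PSet) → Set
  IsChainIn S m c = (∀ i → i ≤ m → IsSubspace (c i) × (c i ⊆ S))
                  × (∀ i → i < m → c i ⊂ c (suc i))

  -- Projective dimension of a singular subspace S, shifted by one: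
  -- DimPlus1 S m  means  dim S = m - 1, i.e. the maximal chains of
  -- subspaces  ∅ = c 0 ⊂ … ⊂ c m = S  have exactly m strict steps.
  -- (So the empty set has DimPlus1 0, a point DimPlus1 1, a line DimPlus1 2.)
  DimPlus1 : PSet → ℕ → Set₁
  DimPlus1 S m =
    (Σ[ c ∈ (ℕ → PSet) ] (IsChainIn S m c × (c 0 ≐ ∅) × (c m ≐ S)))
    × (∀ j (c : ℕ → PSet) → IsChainIn S j c → j ≤ m)

  HasDim : PSet → ℕ → Set₁
  HasDim S k = DimPlus1 S (suc k)

  IsMaximalSingular : PSet → Set₁
  IsMaximalSingular S = IsSingularSubspace S ×
    (∀ (T : PSet) → IsSingularSubspace T → S ⊆ T → T ⊆ S)

record IsPolarSpace (G : Geometry) : Set₁ where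
  open Geometry G
  field
    three-points : ∀ (L : Line) → Σ[ p ∈ Point ] Σ[ q ∈ Point ] Σ[ r ∈ Point ]
      (p I L × q I L × r I L × ¬ (p ≡ q) × ¬ (p ≡ r) × ¬ (q ≡ r))
    unique-line : ∀ (p q : Point) (L M : Line) → ¬ (p ≡ q) →
      p I L → q I L → p I M → q I M → L ≡ M
    no-radical : ∀ (p : Point) → Σ[ q ∈ Point ] ¬ (p ⟂ q)
    one-or-all : ∀ (p : Point) (L : Line) →
      (Σ[ q ∈ Point ] (q I L × p ⟂ q × (∀ q' → q' I L → p ⟂ q' → q' ≡ q)))
      ⊎ (∀ q → q I L → p ⟂ q)
    no-infinite-ascending : ¬ (Σ[ c ∈ (ℕ → PSet) ]
      (∀ i → IsSingularSubspace (c i) × (c i ⊂ c (suc i))))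
    no-infinite-descending : ¬ (Σ[ c ∈ (ℕ → PSet) ]
      (∀ i → IsSingularSubspace (c i) × (c (suc i) ⊂ c i)))

record PolarSpace : Set₂ where
  field
    geom    : Geometry
    isPolar : IsPolarSpace geom
  open Geometry geom public

HasRank : PolarSpace → ℕ → Set₁
HasRank Π n =
  (Σ[ S ∈ PSet ] IsMaximalSingular S)
  × (∀ S → IsMaximalSingular S → DimPlus1 S n)
  where open PolarSpace Π

record Graph : Set₂ where
  field
    V   : Set₁
    _≈_ : V → V → Set
    Adj : V → V → Set₁

module _ (G : Graph) where
  open Graph G
  Walk : V → V → ℕ → Set₁
  Walk x y zero    = Level.Lift _ (x ≈ y)
  Walk x y (suc m) = Σ[ z ∈ V ] (Adj x z × Walk z y m)

  Dist : V → V → ℕ → Set₁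
  Dist x y m = Walk x y m × (∀ j → j < m → ¬ Walk x y j)

record IsEmbedding (G H : Graph) (f : Graph.V G → Graph.V H) : Set₁ where
  private
    module G = Graph G
    module H = Graph H
  field
    respects  : ∀ x y → x G.≈ y → f x H.≈ f y
    injective : ∀ x y → f x H.≈ f y → x G.≈ y
    adj→adj   : ∀ x y → G.Adj x y → H.Adj (f x) (f y)
    adj←adj   : ∀ x y → H.Adj (f x) (f y) → G.Adj x y

record Is3Embedding (G H : Graph) (f : Graph.V G → Graph.V H) : Set₁ where
  field
    embedding : IsEmbedding G H f
    dist-pres : ∀ x y m → m ≤ 3 → Dist G x y m → Dist H (f x) (f y) m

module _ (Π : PolarSpace) where
  open PolarSpace Π

  record KSub (k : ℕ) : Set₁ where
    constructor ksub
    field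
      carrier  : PSet
      singsub  : IsSingularSubspace carrier
      dim      : HasDim carrier k

  record MaxSub : Set₁ where
    constructor maxsub
    field
      carrier : PSet
      maximal : IsMaximalSingular carrier

  GrassmannGraph : ℕ → Graph
  GrassmannGraph k = record
    { V   = KSub k
    ; _≈_ = λ A B → KSub.carrier A ≐ KSub.carrier B
    ; Adj = λ A B → ¬ (KSub.carrier A ≐ KSub.carrier B) ×
                    Σ[ T ∈ PSet ] (IsSingularSubspace T × HasDim T (suc k) ×
                                  (KSub.carrier A ⊆ T) × (KSub.carrier B ⊆ T))
    }

  DualPolarGraph : ℕ → Graph
  DualPolarGraph l = record
    { V   = MaxSub
    ; _≈_ = λ A B → MaxSub.carrier A ≐ MaxSub.carrier B
    ; Adj = λ A B → DimPlus1 (MaxSub.carrier A ∩ MaxSub.carrier B) (l Data.Nat.∸ 1)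
    }

{-# OPTIONS --safe #-}
module Submission where

open import Defs
open import Data.Nat using (ℕ; zero; suc; _≤_; _<_; _+_; _∸_; z≤n; s≤s)
open import Data.Nat.Properties
  using (≤-refl; ≤-trans; ≤-reflexive; ≤-antisym; n≤1+n; m≤n+m; m≤m+n; m≤n⇒m<n∨m≡n; 1+n≰n; n∸n≡0;
         +-∸-assoc; +-comm; +-suc; suc-injective)
open import Data.Product using (Σ-syntax; _×_; _,_; proj₁; proj₂)
open import Data.Sum using (_⊎_; inj₁; inj₂)
open import Data.Empty using (⊥; ⊥-elim)
open import Data.Unit using (⊤; tt)
open import Level using (lift)
open import Data.List using (List; []; _∷_; _++_; length; drop)
open import Data.List.Membership.Propositional using (_∈_)
open import Data.List.Membership.Propositional.Properties using (∈-++⁺ˡ; ∈-++⁺ʳ; ∈-++⁻)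
open import Data.List.Relation.Unary.Any using (here; there)
open import Relation.Nullary using (¬_; Dec; yes; no)
open import Relation.Nullary.Decidable using (decidable-stable)
open import Relation.Binary.PropositionalEquality using (_≡_; refl; sym; trans; cong; subst)

-- Let A₀ ~ A₁ ~ A₂ ~ A₃ be the images of a geodesic of length three. If A₀ were not
-- perpendicular to A₂, a second common neighbour of A₀ and A₂ would force A₀ ∩ A₁ = A₀ ∩ A₂ to
-- be a hyperplane H of A₀, and some ⟨H, w⟩ would be adjacent to both A₀ and A₃, although they
-- are at distance three. So vertices at distance two have perpendicular images, and this
-- propagates to all pairs: a vertex x not adjacent to y has two non-adjacent neighbours closer
-- to y, and the image of x lies in the span of theirs. Finally, A₀ and A₃ are perpendicular and
-- at distance three, so they span a singular subspace of dimension at least k + 3.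
--
-- Constructively, one-or-all makes collinearity and equality of points decidable. The span of a
-- finite clique is taken to be its double perp, in which membership is decidable as well.

-- The quadrangle comes from commuting two moves: if `p ⟂ q`, replacing a maximal subspace `x` by
-- the span of `p` and its points collinear with `p`, and then doing the same with `q`, gives the
-- same result in either order. So `x ▹ p` and `x ▹ q` have the common neighbour `x ▹ p ▹ q` besides
-- `x`. Rank at least three leaves in `x` a point collinear with both `p` and `q`, and moving away
-- from that point prolongs the path to a geodesic of length three. The bound on `k` enters through
-- a point outside `A₀` collinear with all of `A₀`; its existence is known only up to double
-- negation, which is enough because the goal, collinearity, is stable.
--
-- A double perp is a subspace by construction, and not belonging to it has a positive witness: a
-- point collinear with the whole clique but not with the given point. Such witnesses do the work of
-- linear functionals.

module Polar (Π : PolarSpace) where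
  open PolarSpace Π
  open IsPolarSpace isPolar

  -- Collinearity and lines

  ⟂-sym : ∀ {p q} → p ⟂ q → q ⟂ p
  ⟂-sym (inj₁ e) = inj₁ (sym e)
  ⟂-sym (inj₂ (L , pL , qL)) = inj₂ (L , qL , pL)

  Col : Point → Point → Point → Set
  Col p q r = Σ[ L ∈ Line ] (p I L × q I L × r I L)

  col-swap : ∀ {p q r} → Col p q r → Col q p r
  col-swap (L , pL , qL , rL) = L , qL , pL , rL

  col-rot : ∀ {p q r} → Col p q r → Col q r p
  col-rot (L , pL , qL , rL) = L , qL , rL , pL

  col-swap₂₃ : ∀ {p q r} → Col p q r → Col p r q
  col-swap₂₃ (L , pL , qL , rL) = L , pL , rL , qL

  col-⟂ : ∀ {p q r} → Col p q r → p ⟂ q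
  col-⟂ (L , pL , qL , rL) = inj₂ (L , pL , qL)

  meet : ∀ {p q} → p ⟂ q → ¬ (p ≡ q) → ∀ z → Σ[ r ∈ Point ] (Col p q r × z ⟂ r)
  meet (inj₁ e) p≢q z = ⊥-elim (p≢q e)
  meet {p} (inj₂ (L , pL , qL)) _ z with one-or-all z L
  ... | inj₁ (r , rL , z⟂r , _) = r , (L , pL , qL , rL) , z⟂r
  ... | inj₂ all = p , (L , pL , qL , pL) , all p pL

  spread : ∀ {p q r z} → ¬ (p ≡ q) → Col p q r → z ⟂ p → z ⟂ q → z ⟂ r
  spread {p} {q} {r} {z} p≢q (L , pL , qL , rL) z⟂p z⟂q with one-or-all z L
  ... | inj₁ (_ , _ , _ , unique) = ⊥-elim (p≢q (trans (unique p pL z⟂p) (sym (unique q qL z⟂q))))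
  ... | inj₂ all = all r rL

  subspace-col : ∀ {S p q r} → IsSubspace S → ¬ (p ≡ q) → Col p q r → S p → S q → S r
  subspace-col S-sub p≢q (L , pL , qL , rL) Sp Sq = S-sub _ _ L p≢q Sp Sq pL qL _ rL

  -- No hyperbolic line is available, so the point separating a from t is found by
  -- projecting a onto the line joining u to a point of the line st.
  split : ∀ {W a t s u} → IsSubspace W → W t → W s → W u →
    a ⟂ t → s ⟂ t → ¬ (s ⟂ a) → ¬ (u ⟂ t) → Σ[ r ∈ Point ] (W r × a ⟂ r × ¬ (r ⟂ t))
  split {W} {a} {t} {s} {u} W-sub Wt Ws Wu a⟂t s⟂t s̸a u̸t
    with meet s⟂t (λ { refl → s̸a (⟂-sym a⟂t) }) u
  ... | n , stn , u⟂n with meet u⟂n (λ { refl → u̸t (⟂-sym (col-⟂ (col-rot stn))) }) a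
  ... | r , unr , a⟂r = r , Wr , a⟂r , r̸t
    where
    s≢t : ¬ (s ≡ t)
    s≢t refl = s̸a (⟂-sym a⟂t)
    n≢t : ¬ (n ≡ t)
    n≢t refl = u̸t u⟂n
    t⟂n : t ⟂ n
    t⟂n = col-⟂ (col-rot stn)
    u≢n : ¬ (u ≡ n)
    u≢n refl = u̸t (⟂-sym t⟂n)
    Wr : W r
    Wr = subspace-col W-sub u≢n unr Wu (subspace-col W-sub s≢t stn Ws Wt)
    n≢r : ¬ (n ≡ r)
    n≢r refl = s̸a (⟂-sym (spread n≢t (col-swap (col-rot stn)) a⟂r a⟂t))
    r̸t : ¬ (r ⟂ t)
    r̸t r⟂t = u̸t (⟂-sym (spread n≢r (col-rot unr) t⟂n (⟂-sym r⟂t)))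

  -- Perps and double perps of cliques

  _ᗮ : PSet → PSet
  (A ᗮ) q = ∀ r → A r → r ⟂ q

  ᗮ-subspace : ∀ A → IsSubspace (A ᗮ)
  ᗮ-subspace A p q L p≢q Ap Aq pL qL r rL a Aa =
    spread p≢q (L , pL , qL , rL) (Ap a Aa) (Aq a Aa)

  ᗮᗮ-mono : ∀ {A B} → A ⊆ B → (A ᗮ ᗮ) ⊆ (B ᗮ ᗮ)
  ᗮᗮ-mono A⊆B p h z z∈ = h z (λ r Ar → z∈ r (A⊆B r Ar))

  ⊆ᗮᗮ : ∀ {A} → A ⊆ (A ᗮ ᗮ)
  ⊆ᗮᗮ p Ap z z∈ = ⟂-sym (z∈ p Ap)

  ᗮᗮ-least : ∀ {A B} → A ⊆ (B ᗮ) → (A ᗮ ᗮ) ⊆ (B ᗮ)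
  ᗮᗮ-least A⊆ p h b Bb = h b (λ r Ar → ⟂-sym (A⊆ r Ar b Bb))

  ᗮᗮ-⊆ᗮ : ∀ {A} → IsSingular A → (A ᗮ ᗮ) ⊆ (A ᗮ)
  ᗮᗮ-⊆ᗮ sing = ᗮᗮ-least (λ p Ap r Ar → sing r p Ar Ap)

  ᗮᗮ-singular : ∀ {A} → IsSingular A → IsSingular (A ᗮ ᗮ)
  ᗮᗮ-singular sing p q p∈ q∈ = q∈ p (ᗮᗮ-⊆ᗮ sing p p∈)

  ⟦_⟧ : List Point → PSet
  ⟦ ps ⟧ p = p ∈ ps

  Clique : List Point → Set
  Clique ps = IsSingular ⟦ ps ⟧

  ⟨_⟩ : List Point → PSet
  ⟨ ps ⟩ = ⟦ ps ⟧ ᗮ ᗮ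

  ∷-ᗮ : ∀ {p ps z} → p ⟂ z → (⟦ ps ⟧ ᗮ) z → (⟦ p ∷ ps ⟧ ᗮ) z
  ∷-ᗮ p⟂z z∈ r (here refl) = p⟂z
  ∷-ᗮ p⟂z z∈ r (there r∈) = z∈ r r∈

  ∷-⊆ : ∀ {p ps} {A : PSet} → A p → ⟦ ps ⟧ ⊆ A → ⟦ p ∷ ps ⟧ ⊆ A
  ∷-⊆ Ap ps⊆ r (here refl) = Ap
  ∷-⊆ Ap ps⊆ r (there r∈) = ps⊆ r r∈

  tail-⊆ : ∀ {p ps} {A : PSet} → ⟦ p ∷ ps ⟧ ⊆ A → ⟦ ps ⟧ ⊆ A
  tail-⊆ h r r∈ = h r (there r∈)

  clique-⊆ : ∀ {ps A} → ⟦ ps ⟧ ⊆ A → IsSingular A → Clique ps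
  clique-⊆ ps⊆ sing p q p∈ q∈ = sing p q (ps⊆ p p∈) (ps⊆ q q∈)

  clique-tail : ∀ {p ps} → Clique (p ∷ ps) → Clique ps
  clique-tail cl p q p∈ q∈ = cl p q (there p∈) (there q∈)

  clique-∷ : ∀ {p ps} → (⟦ ps ⟧ ᗮ) p → Clique ps → Clique (p ∷ ps)
  clique-∷ p∈ cl _ _ (here refl) (here refl) = inj₁ refl
  clique-∷ p∈ cl _ q (here refl) (there q∈) = ⟂-sym (p∈ q q∈)
  clique-∷ p∈ cl r _ (there r∈) (here refl) = p∈ r r∈
  clique-∷ p∈ cl r q (there r∈) (there q∈) = cl r q r∈ q∈

  ⟨⟩-tail : ∀ {p ps} → ⟨ ps ⟩ ⊆ ⟨ p ∷ ps ⟩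
  ⟨⟩-tail = ᗮᗮ-mono (λ _ → there)

  ⟨⟩-least : ∀ {ps qs} → ⟦ ps ⟧ ⊆ ⟨ qs ⟩ → ⟨ ps ⟩ ⊆ ⟨ qs ⟩
  ⟨⟩-least = ᗮᗮ-least

  ⟨⟩-∈ : ∀ {ps} → ⟦ ps ⟧ ⊆ ⟨ ps ⟩
  ⟨⟩-∈ = ⊆ᗮᗮ

  ⟨⟩-subspace : ∀ ps → IsSubspace ⟨ ps ⟩
  ⟨⟩-subspace ps = ᗮ-subspace (⟦ ps ⟧ ᗮ)

  -- Decidable collinearity and the structure of spans

  module WithLine (L₀ : Line) where

    -- Collinearity with `p` can be tested by `one-or-all` only along a line through `p`; joining
    -- `p` to a point of `L₀` provides one.
    point-line : ∀ p → Σ[ L ∈ Line ] p I L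
    point-line p with one-or-all p L₀ | three-points L₀
    ... | inj₁ (q , qL , inj₁ refl , _) | _ = L₀ , qL
    ... | inj₁ (q , qL , inj₂ (L , pL , _) , _) | _ = L , pL
    ... | inj₂ all | (a , _ , _ , aL , _) with all a aL
    ... | inj₁ refl = L₀ , aL
    ... | inj₂ (L , pL , _) = L , pL

    -- A point r collinear with x but not with all of L satisfies L ∩ r^⊥ = {x};
    -- whether y is that point is read off from one-or-all for y and the line xr.
    ≟-line : ∀ {L} x y → x I L → y I L → Dec (x ≡ y)
    ≟-line {L} x y xL yL with no-radical x
    ... | s , x̸s with one-or-all s L
    ... | inj₂ all = ⊥-elim (x̸s (⟂-sym (all x xL)))
    ... | inj₁ (t , tL , s⟂t , _) with no-radical t
    ... | u , t̸u with split {λ _ → ⊤} {x} {t} {s} {u} (λ _ _ _ _ _ _ _ _ _ _ → tt) tt tt tt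
                       (inj₂ (L , xL , tL)) s⟂t (λ h → x̸s (⟂-sym h)) (λ h → t̸u (⟂-sym h))
    ... | r , _ , inj₁ refl , r̸t = ⊥-elim (r̸t (inj₂ (L , xL , tL)))
    ... | r , _ , inj₂ (M , xM , rM) , r̸t with one-or-all y M
    ... | inj₁ (q , qM , y⟂q , unique) = no λ { refl → r̸t (subst (_⟂ t)
            (trans (unique x xM (inj₁ refl)) (sym (unique r rM (inj₂ (M , xM , rM)))))
            (inj₂ (L , xL , tL))) }
    ... | inj₂ all with one-or-all r L
    ... | inj₁ (q , _ , _ , unique) =
            yes (trans (unique x xL (inj₂ (M , rM , xM))) (sym (unique y yL (⟂-sym (all r rM)))))
    ... | inj₂ all′ = ⊥-elim (r̸t (all′ t tL))

    _⟂?_ : ∀ p q → Dec (p ⟂ q)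
    p ⟂? q with point-line q
    ... | L , qL with one-or-all p L
    ... | inj₂ all = yes (all q qL)
    ... | inj₁ (r , rL , p⟂r , unique) with ≟-line q r qL rL
    ... | yes refl = yes p⟂r
    ... | no q≢r = no (λ p⟂q → q≢r (unique q qL p⟂q))

    _≟_ : (p q : Point) → Dec (p ≡ q)
    p ≟ q with p ⟂? q
    ... | no p̸q = no (λ e → p̸q (inj₁ e))
    ... | yes (inj₁ e) = yes e
    ... | yes (inj₂ (L , pL , qL)) = ≟-line p q pL qL

    ⟂-stable : ∀ {p q} → ¬ ¬ (p ⟂ q) → p ⟂ q
    ⟂-stable {p} {q} = decidable-stable (p ⟂? q)

    -- Induction on the clique. If `a` is not in `⟨ ps ⟩`, as witnessed by `s`, let `t` be the point
    -- of the line `ap` collinear with `s`. Either `t` is in `⟨ ps ⟩`, and `p` lies on the line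
    -- `at`; or `t` has a witness `u` of its own, and `split` combines `s` and `u` into a point
    -- collinear with `a` and not with `t`, hence not with `p`.
    separate : ∀ ps p → Clique (p ∷ ps) → ⟨ ps ⟩ p ⊎ (Σ[ z ∈ Point ] ((⟦ ps ⟧ ᗮ) z × ¬ (z ⟂ p)))
    separate [] p cl with no-radical p
    ... | z , p̸z = inj₂ (z , (λ _ ()) , λ h → p̸z (⟂-sym h))
    separate (a ∷ ps) p cl with separate ps p (clique-⊆ (∷-⊆ (here refl) (λ _ r∈ → there (there r∈))) cl)
    ... | inj₁ h = inj₁ (⟨⟩-tail p h)
    ... | inj₂ (z , zW , z̸p) with separate ps a (clique-tail cl)
    ... | inj₁ h = inj₂ (z , ∷-ᗮ (⟂-sym (h z zW)) zW , z̸p)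
    ... | inj₂ (s , sW , s̸a) with a ≟ p
    ... | yes refl = inj₁ (⟨⟩-∈ a (here refl))
    ... | no a≢p with meet (cl a p (there (here refl)) (here refl)) a≢p s
    ... | t , apt , s⟂t = finish (separate ps t (clique-∷ tW (clique-tail (clique-tail cl))))
      where
      tW : (⟦ ps ⟧ ᗮ) t
      tW = subspace-col (ᗮ-subspace ⟦ ps ⟧) a≢p apt
             (λ r r∈ → cl r a (there (there r∈)) (there (here refl)))
             (λ r r∈ → cl r p (there (there r∈)) (here refl))
      finish : ⟨ ps ⟩ t ⊎ (Σ[ u ∈ Point ] ((⟦ ps ⟧ ᗮ) u × ¬ (u ⟂ t))) →
        ⟨ a ∷ ps ⟩ p ⊎ (Σ[ u ∈ Point ] ((⟦ a ∷ ps ⟧ ᗮ) u × ¬ (u ⟂ p)))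
      finish (inj₁ t∈) = inj₁ (subspace-col (⟨⟩-subspace (a ∷ ps)) (λ { refl → s̸a s⟂t })
                           (col-swap₂₃ apt) (⟨⟩-∈ a (here refl)) (⟨⟩-tail t t∈))
      finish (inj₂ (u , uW , u̸t))
        with split (ᗮ-subspace ⟦ ps ⟧) tW sW uW (col-⟂ (col-swap₂₃ apt)) s⟂t s̸a u̸t
      ... | r , rW , a⟂r , r̸t =
        inj₂ (r , ∷-ᗮ a⟂r rW , λ r⟂p → r̸t (spread a≢p apt (⟂-sym a⟂r) r⟂p))

    decide-⊆ᗮ : ∀ ps q → (⟦ ps ⟧ ᗮ) q ⊎ (Σ[ p ∈ Point ] (p ∈ ps × ¬ (p ⟂ q)))
    decide-⊆ᗮ [] q = inj₁ (λ _ ())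
    decide-⊆ᗮ (p ∷ ps) q with p ⟂? q | decide-⊆ᗮ ps q
    ... | no p̸q | _ = inj₂ (p , here refl , p̸q)
    ... | yes _ | inj₂ (r , r∈ , r̸q) = inj₂ (r , there r∈ , r̸q)
    ... | yes p⟂q | inj₁ h = inj₁ (∷-ᗮ p⟂q h)

    ⟨⟩? : ∀ {ps} → Clique ps → ∀ q → Dec (⟨ ps ⟩ q)
    ⟨⟩? {ps} cl q with decide-⊆ᗮ ps q
    ... | inj₂ (p , p∈ , p̸q) = no (λ h → p̸q (ᗮᗮ-⊆ᗮ cl q h p p∈))
    ... | inj₁ h with separate ps q (clique-∷ h cl)
    ... | inj₁ q∈ = yes q∈
    ... | inj₂ (z , zW , z̸q) = no (λ q∈ → z̸q (q∈ z zW))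

    -- With `z` separating `p` from `⟨ ps ⟩`, the candidate is the point `r` of the line `pq`
    -- collinear with `z`. Were it outside `⟨ ps ⟩`, `split` would produce a point collinear with
    -- `p` and all of `ps` but not with `r`, against `r` being in `⟨ p ∷ ps ⟩`.
    ⟨∷⟩-line : ∀ {p q ps} → Clique (p ∷ ps) → ¬ ⟨ ps ⟩ p → ⟨ p ∷ ps ⟩ q → ¬ (q ≡ p) →
      Σ[ r ∈ Point ] (⟨ ps ⟩ r × Col p q r)
    ⟨∷⟩-line {p} {q} {ps} cl p∉ q∈ q≢p with separate ps p cl
    ... | inj₁ h = ⊥-elim (p∉ h)
    ... | inj₂ (z , zW , z̸p) with meet (q∈ p (λ r r∈ → cl r p r∈ (here refl))) (λ e → q≢p (sym e)) z
    ... | r , pqr , z⟂r = finish (separate ps r (clique-∷ rW (clique-tail cl)))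
      where
      r∈ : ⟨ p ∷ ps ⟩ r
      r∈ = subspace-col (⟨⟩-subspace (p ∷ ps)) (λ e → q≢p (sym e)) pqr (⟨⟩-∈ p (here refl)) q∈
      rW : (⟦ ps ⟧ ᗮ) r
      rW a a∈ = ᗮᗮ-⊆ᗮ cl r r∈ a (there a∈)
      finish : ⟨ ps ⟩ r ⊎ (Σ[ u ∈ Point ] ((⟦ ps ⟧ ᗮ) u × ¬ (u ⟂ r))) → Σ[ r ∈ Point ] (⟨ ps ⟩ r × Col p q r)
      finish (inj₁ r∈ps) = r , r∈ps , pqr
      finish (inj₂ (u , uW , u̸r))
        with split (ᗮ-subspace ⟦ ps ⟧) rW zW uW (col-⟂ (col-swap₂₃ pqr)) z⟂r z̸p u̸r
      ... | y , yW , p⟂y , y̸r = ⊥-elim (y̸r (r∈ y (∷-ᗮ p⟂y yW)))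

    -- This identifies the double perp of a clique with the subspace that the clique generates. The
    -- base case is the absence of a radical: nothing is collinear with every point.
    span-⊆ : ∀ {S} → IsSubspace S → ∀ ps → Clique ps → ⟦ ps ⟧ ⊆ S → ⟨ ps ⟩ ⊆ S
    span-⊆ S-sub [] cl ps⊆ q q∈ with no-radical q
    ... | z , q̸z = ⊥-elim (q̸z (⟂-sym (q∈ z (λ _ ()))))
    span-⊆ S-sub (p ∷ ps) cl ps⊆ q q∈ with q ≟ p
    ... | yes refl = ps⊆ q (here refl)
    ... | no q≢p with ⟨⟩? (clique-tail cl) p
    ... | yes p∈ = span-⊆ S-sub ps (clique-tail cl) (tail-⊆ ps⊆) q (⟨⟩-least {p ∷ ps} {ps} (∷-⊆ p∈ ⟨⟩-∈) q q∈)
    ... | no p∉ with ⟨∷⟩-line cl p∉ q∈ q≢p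
    ... | r , r∈ , pqr = subspace-col S-sub (λ { refl → p∉ r∈ }) (col-swap₂₃ pqr)
                           (ps⊆ p (here refl)) (span-⊆ S-sub ps (clique-tail cl) (tail-⊆ ps⊆) r r∈)

    ⟨[]⟩-empty : ∀ {r} → ¬ ⟨ [] ⟩ r
    ⟨[]⟩-empty {r} = span-⊆ {∅} (λ _ _ _ _ ()) [] (λ _ _ ()) (λ _ ()) r

    -- Exchange and independence

    exchange : ∀ {p q ps} → Clique (p ∷ ps) → ⟨ p ∷ ps ⟩ q → ¬ ⟨ ps ⟩ q → ⟨ q ∷ ps ⟩ p
    exchange {p} {q} {ps} cl q∈ q∉ with q ≟ p
    ... | yes refl = ⟨⟩-∈ q (here refl)
    ... | no q≢p with ⟨⟩? (clique-tail cl) p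
    ... | yes p∈ = ⊥-elim (q∉ (⟨⟩-least {p ∷ ps} {ps} (∷-⊆ p∈ ⟨⟩-∈) q q∈))
    ... | no p∉ with ⟨∷⟩-line cl p∉ q∈ q≢p
    ... | r , r∈ , pqr = subspace-col (⟨⟩-subspace (q ∷ ps)) (λ { refl → q∉ r∈ }) (col-rot pqr)
                           (⟨⟩-∈ q (here refl)) (⟨⟩-tail r r∈)

    ++-⊆ : ∀ {A : PSet} B C → ⟦ B ⟧ ⊆ A → ⟦ C ⟧ ⊆ A → ⟦ B ++ C ⟧ ⊆ A
    ++-⊆ B C B⊆ C⊆ r r∈ with ∈-++⁻ B r∈
    ... | inj₁ r∈B = B⊆ r r∈B
    ... | inj₂ r∈C = C⊆ r r∈C

    ++-mid : ∀ B {x C} → ⟦ B ++ C ⟧ ⊆ ⟦ B ++ x ∷ C ⟧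
    ++-mid B {C = C} = ++-⊆ B C (λ _ → ∈-++⁺ˡ) (λ _ h → ∈-++⁺ʳ B (there h))

    -- `B` holds the vectors already exchanged and must survive. Entries of `C` are passed over as
    -- long as `q` stays in the span without them; the first `x` whose removal expels `q` is the one
    -- replaced.
    steinitz-step : ∀ {q} B C → Clique (B ++ C) → ⟨ B ++ C ⟩ q → ¬ ⟨ B ⟩ q →
      Σ[ D ∈ List Point ] (length C ≡ suc (length D) × ⟦ D ⟧ ⊆ ⟦ C ⟧ × ⟦ C ⟧ ⊆ ⟨ q ∷ B ++ D ⟩)
    steinitz-step {q} B [] cl q∈ q∉ = ⊥-elim (q∉ (ᗮᗮ-mono (++-⊆ B [] (λ _ h → h) (λ _ ())) q q∈))
    steinitz-step {q} B (x ∷ C) cl q∈ q∉ with ⟨⟩? {B ++ C} (clique-⊆ (++-mid B) cl) q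
    ... | yes q∈′ with steinitz-step B C (clique-⊆ (++-mid B) cl) q∈′ q∉
    ... | D , eq , D⊆C , C⊆ = x ∷ D , cong suc eq , ∷-⊆ (here refl) (λ r r∈ → there (D⊆C r r∈)) ,
            ∷-⊆ (⟨⟩-∈ x (there (∈-++⁺ʳ B (here refl)))) (λ r r∈ → ᗮᗮ-mono
              (∷-⊆ (here refl) (++-⊆ B D (λ _ h → there (∈-++⁺ˡ h)) (λ _ h → there (∈-++⁺ʳ B (there h)))))
              r (C⊆ r r∈))
    steinitz-step {q} B (x ∷ C) cl q∈ q∉ | no q∉′ =
      C , refl , (λ _ → there) ,
      ∷-⊆ (exchange (clique-⊆ gather cl) (ᗮᗮ-mono gather⁻¹ q q∈) q∉′)
          (λ r r∈ → ⟨⟩-∈ r (there (∈-++⁺ʳ B r∈)))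
      where
      gather : ⟦ x ∷ B ++ C ⟧ ⊆ ⟦ B ++ x ∷ C ⟧
      gather = ∷-⊆ (∈-++⁺ʳ B (here refl)) (++-mid B)
      gather⁻¹ : ⟦ B ++ x ∷ C ⟧ ⊆ ⟦ x ∷ B ++ C ⟧
      gather⁻¹ = ++-⊆ B (x ∷ C) (λ _ h → there (∈-++⁺ˡ h))
                   (∷-⊆ (here refl) (λ _ h → there (∈-++⁺ʳ B h)))

    Indep : List Point → Set
    Indep [] = ⊤
    Indep (p ∷ ps) = ¬ ⟨ ps ⟩ p × Indep ps

    steinitz : ∀ qs ps → Clique ps → Indep qs → ⟦ qs ⟧ ⊆ ⟨ ps ⟩ →
      Σ[ D ∈ List Point ] (length ps ≡ length qs + length D × ⟦ D ⟧ ⊆ ⟦ ps ⟧ × ⟦ ps ⟧ ⊆ ⟨ qs ++ D ⟩)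
    steinitz [] ps cl ind qs⊆ = ps , refl , (λ _ h → h) , ⟨⟩-∈
    steinitz (q ∷ qs) ps cl (q∉ , ind) qs⊆ with steinitz qs ps cl ind (tail-⊆ qs⊆)
    ... | D , eq , D⊆ps , ps⊆
      with steinitz-step qs D (clique-⊆ (++-⊆ qs D (tail-⊆ qs⊆) (λ r r∈ → ⟨⟩-∈ r (D⊆ps r r∈))) (ᗮᗮ-singular cl))
             (⟨⟩-least {ps} {qs ++ D} ps⊆ q (qs⊆ q (here refl))) q∉
    ... | E , eq′ , E⊆D , D⊆ =
      E , trans eq (trans (cong (length qs +_) eq′) (+-suc (length qs) (length E))) ,
      (λ r r∈ → D⊆ps r (E⊆D r r∈)) ,
      (λ r r∈ → ⟨⟩-least {qs ++ D} {q ∷ qs ++ E}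
        (++-⊆ qs D (λ s s∈ → ⟨⟩-∈ s (there (∈-++⁺ˡ s∈))) D⊆) r (ps⊆ r r∈))

    indep-≤ : ∀ {qs ps} → Clique ps → Indep qs → ⟦ qs ⟧ ⊆ ⟨ ps ⟩ → length qs ≤ length ps
    indep-≤ {qs} {ps} cl ind qs⊆ with steinitz qs ps cl ind qs⊆
    ... | D , eq , _ = ≤-trans (m≤m+n (length qs) (length D)) (≤-reflexive (sym eq))

    -- Chains, bases and dimension

    chain→list : ∀ {S} → IsSingular S → ∀ j c → IsChainIn S j c →
      Σ[ vs ∈ List Point ] (length vs ≡ j × Indep vs × ⟦ vs ⟧ ⊆ c j)
    chain→list sing zero c ch = [] , refl , tt , λ _ ()
    chain→list {S} sing (suc j) c (sub , step)
      with chain→list sing j c ((λ i i≤ → sub i (≤-trans i≤ (n≤1+n j))) , (λ i i< → step i (≤-trans i< (n≤1+n j))))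
    ... | vs , eq , ind , vs⊆ with step j ≤-refl
    ... | cj⊆ , p , p∈ , p∉ = p ∷ vs , cong suc eq ,
          ((λ h → p∉ (span-⊆ (proj₁ (sub j (n≤1+n j))) vs
                       (clique-⊆ (λ r r∈ → proj₂ (sub j (n≤1+n j)) r (vs⊆ r r∈)) sing) vs⊆ p h)) , ind) ,
          ∷-⊆ p∈ (λ r r∈ → cj⊆ r (vs⊆ r r∈))

    drop-∷ : ∀ (vs : List Point) i → i < length vs →
      Σ[ v ∈ Point ] drop (length vs ∸ suc i) vs ≡ v ∷ drop (length vs ∸ i) vs
    drop-∷ (v ∷ vs) i (s≤s i≤) with m≤n⇒m<n∨m≡n i≤
    ... | inj₂ refl rewrite n∸n≡0 i | +-∸-assoc 1 (≤-refl {length vs}) | n∸n≡0 (length vs) = v , refl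
    ... | inj₁ i< with drop-∷ vs i i<
    ... | w , eq rewrite +-∸-assoc 1 i≤ | +-∸-assoc 1 i< = w , eq

    indep-drop : ∀ k vs → Indep vs → Indep (drop k vs)
    indep-drop zero vs ind = ind
    indep-drop (suc k) [] ind = tt
    indep-drop (suc k) (v ∷ vs) (_ , ind) = indep-drop k vs ind

    drop-⊆ : ∀ k (vs : List Point) → ⟦ drop k vs ⟧ ⊆ ⟦ vs ⟧
    drop-⊆ zero vs r r∈ = r∈
    drop-⊆ (suc k) (v ∷ vs) r r∈ = there (drop-⊆ k vs r r∈)

    -- `Indep` places each entry outside the span of its tail, so the strict chain consists of the
    -- spans of suffixes; the `i`-th member is spanned by the last `i` entries.
    list→chain : ∀ {S} → IsSingularSubspace S → ∀ vs → Indep vs → ⟦ vs ⟧ ⊆ S →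
      IsChainIn S (length vs) (λ i → ⟨ drop (length vs ∸ i) vs ⟩)
    list→chain {S} (S-sub , sing) vs ind vs⊆ =
      (λ i _ → ⟨⟩-subspace (drop (length vs ∸ i) vs) ,
               span-⊆ S-sub (drop (length vs ∸ i) vs) (clique-⊆ (drop⊆S i) sing) (drop⊆S i)) ,
      step
      where
      drop⊆S : ∀ i → ⟦ drop (length vs ∸ i) vs ⟧ ⊆ S
      drop⊆S i r r∈ = vs⊆ r (drop-⊆ (length vs ∸ i) vs r r∈)
      step : ∀ i → i < length vs → ⟨ drop (length vs ∸ i) vs ⟩ ⊂ ⟨ drop (length vs ∸ suc i) vs ⟩
      step i i< with drop (length vs ∸ suc i) vs | drop-∷ vs i i< | indep-drop (length vs ∸ suc i) vs ind
      ... | _ | v , refl | v∉ , _ = ⟨⟩-tail , v , ⟨⟩-∈ v (here refl) , v∉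

    -- A finite substitute for `DimPlus1 A m`, with the same shift: `m` is the projective dimension
    -- plus one. It makes membership in `A` decidable.
    record Basis (A : PSet) (m : ℕ) : Set where
      field
        vectors : List Point
        length≡ : length vectors ≡ m
        indep   : Indep vectors
        clique  : Clique vectors
        spans   : A ≐ ⟨ vectors ⟩

    open Basis

    list-basis : ∀ vs → Clique vs → Indep vs → Basis ⟨ vs ⟩ (length vs)
    list-basis vs cl ind = record
      { vectors = vs ; length≡ = refl ; indep = ind ; clique = cl ; spans = (λ _ h → h) , (λ _ h → h) }

    vectors-⊆ : ∀ {A m} (b : Basis A m) → ⟦ vectors b ⟧ ⊆ A
    vectors-⊆ b r r∈ = proj₂ (spans b) r (⟨⟩-∈ r r∈)

    basis-subspace : ∀ {A m} → Basis A m → IsSubspace A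
    basis-subspace b p q L p≢q Ap Aq pL qL r rL =
      proj₂ (spans b) r (⟨⟩-subspace (vectors b) p q L p≢q (proj₁ (spans b) p Ap) (proj₁ (spans b) q Aq) pL qL r rL)

    basis-singular : ∀ {A m} → Basis A m → IsSingular A
    basis-singular b p q Ap Aq = ᗮᗮ-singular (clique b) p q (proj₁ (spans b) p Ap) (proj₁ (spans b) q Aq)

    basis? : ∀ {A m} → Basis A m → ∀ q → Dec (A q)
    basis? b q with ⟨⟩? (clique b) q
    ... | yes q∈ = yes (proj₂ (spans b) q q∈)
    ... | no q∉ = no (λ Aq → q∉ (proj₁ (spans b) q Aq))

    basis-≐ : ∀ {A B m} → A ≐ B → Basis A m → Basis B m
    basis-≐ (A⊆B , B⊆A) b = record
      { vectors = vectors b ; length≡ = length≡ b ; indep = indep b ; clique = clique b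
      ; spans = (λ r Br → proj₁ (spans b) r (B⊆A r Br)) , (λ r r∈ → A⊆B r (proj₂ (spans b) r r∈)) }

    basis-≤ : ∀ {A B m n} → Basis A m → Basis B n → A ⊆ B → m ≤ n
    basis-≤ a b A⊆B = subst (_≤ _) (length≡ a) (subst (_ ≤_) (length≡ b)
      (indep-≤ (clique b) (indep a) (λ r r∈ → proj₁ (spans b) r (A⊆B r (vectors-⊆ a r r∈)))))

    basis-extend : ∀ {A m v} (b : Basis A m) → (A ᗮ) v → ¬ A v → Basis ⟨ v ∷ vectors b ⟩ (suc m)
    basis-extend {v = v} b v⟂A v∉A = record
      { vectors = v ∷ vectors b ; length≡ = cong suc (length≡ b)
      ; indep = (λ h → v∉A (proj₂ (spans b) v h)) , indep b
      ; clique = clique-∷ (λ r r∈ → v⟂A r (vectors-⊆ b r r∈)) (clique b)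
      ; spans = (λ _ h → h) , (λ _ h → h) }

    basis-span : ∀ {A S m} (b : Basis A m) → IsSubspace S → ⟦ vectors b ⟧ ⊆ S → A ⊆ S
    basis-span b S-sub vs⊆ q Aq = span-⊆ S-sub (vectors b) (clique b) vs⊆ q (proj₁ (spans b) q Aq)

    basis-full : ∀ {A B m} → Basis A m → Basis B m → A ⊆ B → B ⊆ A
    basis-full {A} {B} a b A⊆B q Bq with basis? a q
    ... | yes Aq = Aq
    ... | no q∉A = ⊥-elim (1+n≰n (basis-≤ (basis-extend a (λ r Ar → basis-singular b r q (A⊆B r Ar) Bq) q∉A) b
            (span-⊆ (basis-subspace b) (q ∷ vectors a)
              (clique-⊆ (q∷as⊆) (basis-singular b)) q∷as⊆)))
      where
      q∷as⊆ : ⟦ q ∷ vectors a ⟧ ⊆ B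
      q∷as⊆ = ∷-⊆ Bq (λ r r∈ → A⊆B r (vectors-⊆ a r r∈))

    -- Testing the basis vectors of `A` suffices, so a failing inclusion comes with an explicit
    -- witness.
    escape : ∀ {A B m} → Basis A m → IsSubspace B → (∀ q → Dec (B q)) →
      A ⊆ B ⊎ (Σ[ p ∈ Point ] (A p × ¬ B p))
    escape {A} {B} a B-sub B? with search (vectors a) (vectors-⊆ a)
      where
      search : ∀ ps → ⟦ ps ⟧ ⊆ A → ⟦ ps ⟧ ⊆ B ⊎ (Σ[ p ∈ Point ] (A p × ¬ B p))
      search [] ps⊆ = inj₁ (λ _ ())
      search (p ∷ ps) ps⊆ with B? p | search ps (tail-⊆ ps⊆)
      ... | no p∉ | _ = inj₂ (p , ps⊆ p (here refl) , p∉)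
      ... | yes _ | inj₂ found = inj₂ found
      ... | yes p∈ | inj₁ h = inj₁ (∷-⊆ p∈ h)
    ... | inj₁ h = inj₁ (basis-span a B-sub h)
    ... | inj₂ found = inj₂ found

    basis-escape : ∀ {A B m n} → Basis A m → Basis B n → A ⊆ B ⊎ (Σ[ p ∈ Point ] (A p × ¬ B p))
    basis-escape a b = escape a (basis-subspace b) (basis? b)

    abstract
      -- The points picked along the longest chain span `A`, because a point outside their span
      -- would give a chain longer than `upper` allows.
      dim→basis : ∀ {A m} → IsSingularSubspace A → DimPlus1 A m → Basis A m
      dim→basis {A} {m} (A-sub , sing) ((c , ch , _ , cm⊆A , _) , upper) with chain→list sing m c ch
      ... | vs , refl , ind , vs⊆c = record
        { vectors = vs ; length≡ = refl ; indep = ind ; clique = cl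
        ; spans = A⊆ , span-⊆ A-sub vs cl vs⊆ }
        where
        vs⊆ : ⟦ vs ⟧ ⊆ A
        vs⊆ r r∈ = cm⊆A r (vs⊆c r r∈)
        cl : Clique vs
        cl = clique-⊆ vs⊆ sing
        A⊆ : A ⊆ ⟨ vs ⟩
        A⊆ q Aq with ⟨⟩? cl q
        ... | yes q∈ = q∈
        ... | no q∉ = ⊥-elim (1+n≰n (upper _ _ (list→chain (A-sub , sing) (q ∷ vs) (q∉ , ind) (∷-⊆ Aq vs⊆))))

      basis→dim : ∀ {A m} → Basis A m → DimPlus1 A m
      basis→dim {A} b = subst (DimPlus1 A) (length≡ b)
        ((_ , list→chain A-ss (vectors b) (indep b) (vectors-⊆ b) , empty , whole) , upper)
        where
        A-ss : IsSingularSubspace A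
        A-ss = basis-subspace b , basis-singular b
        drop-all : ∀ ws → drop (length ws) ws ≡ ([] {A = Point})
        drop-all [] = refl
        drop-all (w ∷ ws) = drop-all ws
        empty : ⟨ drop (length (vectors b)) (vectors b) ⟩ ≐ ∅
        empty rewrite drop-all (vectors b) = (λ _ → ⟨[]⟩-empty) , λ _ ()
        whole : ⟨ drop (length (vectors b) ∸ length (vectors b)) (vectors b) ⟩ ≐ A
        whole rewrite n∸n≡0 (length (vectors b)) = proj₂ (spans b) , proj₁ (spans b)
        upper : ∀ j c → IsChainIn A j c → j ≤ length (vectors b)
        upper j c ch with chain→list (proj₂ A-ss) j c ch
        ... | qs , refl , ind , qs⊆ =
          indep-≤ (clique b) ind (λ r r∈ → proj₁ (spans b) r (proj₂ (proj₁ ch j ≤-refl) r (qs⊆ r r∈)))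

    -- Hyperplanes of singular subspaces

    IsHyperplane : PSet → PSet → Set
    IsHyperplane T H = ∀ p q → T p → T q → ¬ H p → ¬ (p ≡ q) → Σ[ r ∈ Point ] (H r × Col p q r)

    basis-hyperplane : ∀ {T H m} → Basis T (suc m) → Basis H m → H ⊆ T → IsHyperplane T H
    basis-hyperplane {T} {H} {m} t h H⊆T p q Tp Tq p∉H p≢q
      with ⟨∷⟩-line (clique e) (λ k → p∉H (proj₂ (spans h) p k))
             (basis-full e t (span-⊆ (basis-subspace t) (vectors e) (clique e)
               (∷-⊆ Tp (λ r r∈ → H⊆T r (vectors-⊆ h r r∈)))) q Tq) (λ e → p≢q (sym e))
      where
      e : Basis ⟨ p ∷ vectors h ⟩ (suc m)
      e = basis-extend h (λ r Hr → basis-singular t r p (H⊆T r Hr) Tp) p∉H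
    ... | r , r∈ , pqr = r , proj₂ (spans h) r r∈ , pqr

    extract : ∀ ps → Clique ps → Σ[ vs ∈ List Point ] (Clique vs × Indep vs × ⟦ vs ⟧ ⊆ ⟦ ps ⟧ × ⟦ ps ⟧ ⊆ ⟨ vs ⟩)
    extract [] cl = [] , cl , tt , (λ _ ()) , (λ _ ())
    extract (p ∷ ps) cl with extract ps (clique-tail cl)
    ... | vs , cl′ , ind , vs⊆ , ⊆vs with ⟨⟩? cl′ p
    ... | yes p∈ = vs , cl′ , ind , (λ r r∈ → there (vs⊆ r r∈)) , ∷-⊆ p∈ ⊆vs
    ... | no p∉ = p ∷ vs , clique-⊆ sub cl , (p∉ , ind) , sub , ∷-⊆ (⟨⟩-∈ p (here refl)) (λ r r∈ → ⟨⟩-tail r (⊆vs r r∈))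
      where
      sub : ⟦ p ∷ vs ⟧ ⊆ ⟦ p ∷ ps ⟧
      sub = ∷-⊆ (here refl) (λ r r∈ → there (vs⊆ r r∈))

    abstract
      -- A basis of H is extracted from the projections from p to H of the basis vectors of T.
      hyperplane-basis : ∀ {T H m p} → Basis T (suc m) → IsSubspace H → H ⊆ T → T p → ¬ H p →
        (∀ q → T q → ¬ (p ≡ q) → Σ[ r ∈ Point ] (H r × Col p q r)) → Basis H m
      hyperplane-basis {T} {H} {m} {p} t H-sub H⊆T Tp p∉H project
        with shadows (vectors t) (vectors-⊆ t)
        where
        shadows : ∀ ps → ⟦ ps ⟧ ⊆ T → Σ[ hs ∈ List Point ] (⟦ hs ⟧ ⊆ H × ⟦ ps ⟧ ⊆ ⟨ p ∷ hs ⟩)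
        shadows [] ps⊆ = [] , (λ _ ()) , (λ _ ())
        shadows (q ∷ ps) ps⊆ with shadows ps (tail-⊆ ps⊆) | p ≟ q
        ... | hs , hs⊆ , ⊆hs | yes refl = hs , hs⊆ , ∷-⊆ (⟨⟩-∈ p (here refl)) ⊆hs
        ... | hs , hs⊆ , ⊆hs | no p≢q with project q (ps⊆ q (here refl)) p≢q
        ... | r , Hr , pqr = r ∷ hs , ∷-⊆ Hr hs⊆ ,
              ∷-⊆ (subspace-col (⟨⟩-subspace (p ∷ r ∷ hs)) (λ { refl → p∉H Hr })
                    (col-swap₂₃ pqr) (⟨⟩-∈ p (here refl)) (⟨⟩-∈ r (there (here refl))))
                  (λ s s∈ → ᗮᗮ-mono (∷-⊆ (here refl) (λ _ h → there (there h))) s (⊆hs s s∈))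
      ... | hs , hs⊆ , ⊆hs with extract hs (clique-⊆ (λ r r∈ → H⊆T r (hs⊆ r r∈)) (basis-singular t))
      ... | vs , cl , ind , vs⊆ , ⊆vs = record
        { vectors = vs ; length≡ = suc-injective (≤-antisym (basis-≤ e t e⊆T) (basis-≤ t e T⊆e))
        ; indep = ind ; clique = cl ; spans = H⊆vs , vs⊆H }
        where
        vs⊆H : ⟨ vs ⟩ ⊆ H
        vs⊆H = span-⊆ H-sub vs cl (λ r r∈ → hs⊆ r (vs⊆ r r∈))
        e : Basis ⟨ p ∷ vs ⟩ (suc (length vs))
        e = basis-extend (list-basis vs cl ind) (λ r r∈ → basis-singular t r p (H⊆T r (vs⊆H r r∈)) Tp)
              (λ h → p∉H (vs⊆H p h))
        e⊆T : ⟨ p ∷ vs ⟩ ⊆ T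
        e⊆T = span-⊆ (basis-subspace t) (p ∷ vs) (clique e)
                (∷-⊆ Tp (λ r r∈ → H⊆T r (hs⊆ r (vs⊆ r r∈))))
        T⊆e : T ⊆ ⟨ p ∷ vs ⟩
        T⊆e = basis-span t (⟨⟩-subspace (p ∷ vs)) (λ r r∈ → ⟨⟩-least {p ∷ hs} {p ∷ vs}
                (∷-⊆ (⟨⟩-∈ p (here refl)) (λ s s∈ → ⟨⟩-tail s (⊆vs s s∈))) r (⊆hs r r∈))
        H⊆vs : H ⊆ ⟨ vs ⟩
        H⊆vs q Hq with ⟨⟩? cl q
        ... | yes q∈ = q∈
        ... | no q∉ with ⟨∷⟩-line (clique e) (λ h → p∉H (vs⊆H p h)) (T⊆e q (H⊆T q Hq)) (λ { refl → p∉H Hq })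
        ... | r , r∈ , pqr = ⊥-elim (p∉H (subspace-col H-sub (λ { refl → q∉ r∈ }) (col-rot pqr) Hq (vs⊆H r r∈)))

    Perp : PSet → PSet → Set
    Perp A B = ∀ p q → A p → B q → p ⟂ q

    -- If `q` were outside `B`, the line `qp` would meet `B` in a second point collinear with `z`,
    -- and then `p` would be collinear with `z` too.
    hyperplane-foot : ∀ {A B p q z} → (∀ r → Dec (B r)) → IsHyperplane A B →
      A p → ¬ (p ⟂ z) → (∀ r → B r → r ⟂ z) → A q → q ⟂ z → B q
    hyperplane-foot {p = p} {q} B? hyp Ap p̸z B⟂z Aq q⟂z with B? q
    ... | yes Bq = Bq
    ... | no q∉ with hyp q p Aq Ap q∉ (λ { refl → p̸z q⟂z })
    ... | r , Br , qpr = ⊥-elim (p̸z (⟂-sym (spread (λ { refl → q∉ Br }) (col-swap₂₃ qpr)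
                           (⟂-sym q⟂z) (⟂-sym (B⟂z r Br)))))

    ⟨⟩-ᗮ : ∀ {ps z} → (⟦ ps ⟧ ᗮ) z → (⟨ ps ⟩ ᗮ) z
    ⟨⟩-ᗮ z∈ r r∈ = ⟂-sym (r∈ _ z∈)

    basis-suc : ∀ {A m p} → Basis A m → A p → Σ[ m′ ∈ ℕ ] m ≡ suc m′
    basis-suc {A} {p = p} b Ap = go (vectors b) (length≡ b) (proj₁ (spans b) p Ap)
      where
      go : ∀ {m} vs → length vs ≡ m → ⟨ vs ⟩ p → Σ[ m′ ∈ ℕ ] m ≡ suc m′
      go [] _ p∈ = ⊥-elim (⟨[]⟩-empty p∈)
      go (v ∷ vs) eq _ = length vs , sym eq

    -- Adjacency and distance in the polar Grassmann graph

    module _ {k : ℕ} where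

      open KSub

      private
        Γ : Graph
        Γ = GrassmannGraph Π k

      open Graph Γ using (Adj)

      kbasis : (A : KSub Π k) → Basis (carrier A) (suc k)
      kbasis A = dim→basis (singsub A) (dim A)

      fromBasis : ∀ {A} → Basis A (suc k) → KSub Π k
      fromBasis {A} b = ksub A (basis-subspace b , basis-singular b) (basis→dim b)

      adj-sym : ∀ {A B} → Adj A B → Adj B A
      adj-sym (A≢B , T , T-ss , T-dim , A⊆T , B⊆T) =
        (λ (B⊆A , A⊆B) → A≢B (A⊆B , B⊆A)) , T , T-ss , T-dim , B⊆T , A⊆T

      adj-perp : ∀ {A B} → Adj A B → Perp (carrier A) (carrier B)
      adj-perp (_ , _ , (_ , sing) , _ , A⊆T , B⊆T) p q Ap Bq = sing p q (A⊆T p Ap) (B⊆T q Bq)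

      -- `B` is a hyperplane of the common `(k+1)`-space. As `IsHyperplane` does not ask for
      -- inclusion, it can be stated for `A` against `B` directly; the point found lies on a line of
      -- `A`, hence in the intersection of the two.
      adj-hyperplane : ∀ {A B} → Adj A B → IsHyperplane (carrier A) (carrier B)
      adj-hyperplane {A} {B} (_ , _ , T-ss , T-dim , A⊆T , B⊆T) p q Ap Aq =
        basis-hyperplane (dim→basis T-ss T-dim) (kbasis B) B⊆T p q (A⊆T p Ap) (A⊆T q Aq)

      adj-extend : ∀ {A B y} → (carrier A ᗮ) y → ¬ carrier A y →
        carrier B ⊆ ⟨ y ∷ vectors (kbasis A) ⟩ → ¬ (carrier A ≐ carrier B) → Adj A B
      adj-extend {A} y⟂A y∉A B⊆ A≢B =
        A≢B , _ , (basis-subspace e , basis-singular e) , basis→dim e ,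
        (λ r Ar → ⟨⟩-tail r (proj₁ (spans (kbasis A)) r Ar)) , B⊆
        where e = basis-extend (kbasis A) y⟂A y∉A

      Far : KSub Π k → KSub Π k → Set₁
      Far A B = ∀ j → j < 3 → ¬ Walk Γ A B j

      far-≢ : ∀ {A B} → Far A B → ¬ (carrier A ≐ carrier B)
      far-≢ far A≐B = far 0 (s≤s z≤n) (lift A≐B)

      far-¬adj : ∀ {A B} → Far A B → ¬ Adj A B
      far-¬adj {A} {B} far AB = far 1 (s≤s (s≤s z≤n)) (B , AB , lift ((λ _ h → h) , (λ _ h → h)))

      far-¬adj² : ∀ {A B} → Far A B → ∀ C → Adj A C → ¬ Adj C B
      far-¬adj² {A} {B} far C AC CB =
        far 2 (s≤s (s≤s (s≤s z≤n))) (C , AC , B , CB , lift ((λ _ h → h) , (λ _ h → h)))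

      -- Suppose `p₀` and `p₂` are not collinear. The argument divides according to whether `H`, the
      -- intersection of `A₀` and `A₂`, lies in `A₃`; either way `A₀` and `A₃` come closer than
      -- distance three.
      quadrangle-perp : (A₀ A₁ A₁′ A₂ A₃ : KSub Π k) →
        ¬ ¬ (Σ[ v ∈ Point ] ((carrier A₀ ᗮ) v × ¬ carrier A₀ v)) →
        Adj A₀ A₁ → Adj A₁ A₂ → Adj A₀ A₁′ → Adj A₁′ A₂ → ¬ (carrier A₁ ≐ carrier A₁′) →
        Adj A₂ A₃ → Far A₀ A₃ → Perp (carrier A₀) (carrier A₂)
      quadrangle-perp A₀ A₁ A₁′ A₂ A₃ room A₀₁ A₁₂ A₀₁′ A₁₂′ A₁≢A₁′ A₂₃ far p₀ p₂ A₀p₀ A₂p₂ =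
        ⟂-stable contra
        where
        a₀ = kbasis A₀
        a₁ = kbasis A₁
        a₁′ = kbasis A₁′
        a₂ = kbasis A₂
        a₃ = kbasis A₃
        contra : ¬ ¬ (p₀ ⟂ p₂)
        contra p₀̸p₂ = cases (basis-escape hb a₃)
          where
          -- All of `A₁` and `A₁′` is collinear with `p₂`, while `p₀` is not, so both contain every
          -- point of `A₀` collinear with `p₂`. The same holds with the roles of `A₀` and `A₂`
          -- exchanged.
          A₀p₂⊆A₁ : ∀ q → carrier A₀ q → q ⟂ p₂ → carrier A₁ q
          A₀p₂⊆A₁ q A₀q = hyperplane-foot (basis? a₁) (adj-hyperplane {A₀} {A₁} A₀₁) A₀p₀ p₀̸p₂
            (λ r A₁r → adj-perp {A₁} {A₂} A₁₂ r p₂ A₁r A₂p₂) A₀q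

          A₀p₂⊆A₁′ : ∀ q → carrier A₀ q → q ⟂ p₂ → carrier A₁′ q
          A₀p₂⊆A₁′ q A₀q = hyperplane-foot (basis? a₁′) (adj-hyperplane {A₀} {A₁′} A₀₁′) A₀p₀ p₀̸p₂
            (λ r A₁r → adj-perp {A₁′} {A₂} A₁₂′ r p₂ A₁r A₂p₂) A₀q

          A₂p₀⊆A₁′ : ∀ q → carrier A₂ q → q ⟂ p₀ → carrier A₁′ q
          A₂p₀⊆A₁′ q A₂q = hyperplane-foot (basis? a₁′)
            (adj-hyperplane {A₂} {A₁′} (adj-sym {A₁′} {A₂} A₁₂′)) A₂p₂ (λ h → p₀̸p₂ (⟂-sym h))
            (λ r A₁r → ⟂-sym (adj-perp {A₀} {A₁′} A₀₁′ p₀ r A₀p₀ A₁r)) A₂q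

          -- A point h of A₀ ∩ A₁ outside A₂ would give A₁ = ⟨h, A₁ ∩ A₂⟩ = A₁′.
          A₀A₁⊆A₂ : ∀ h → carrier A₀ h → carrier A₁ h → ¬ ¬ carrier A₂ h
          A₀A₁⊆A₂ h A₀h A₁h h∉A₂ = A₁≢A₁′ (A₁⊆A₁′ , basis-full a₁ a₁′ A₁⊆A₁′)
            where
            A₁′h : carrier A₁′ h
            A₁′h = A₀p₂⊆A₁′ h A₀h (adj-perp {A₁} {A₂} A₁₂ h p₂ A₁h A₂p₂)
            A₁⊆A₁′ : carrier A₁ ⊆ carrier A₁′
            A₁⊆A₁′ x A₁x with h ≟ x
            ... | yes refl = A₁′h
            ... | no h≢x with adj-hyperplane {A₁} {A₂} A₁₂ h x A₁h A₁x h∉A₂ h≢x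
            ... | r , A₂r , hxr = subspace-col (basis-subspace a₁′) (λ { refl → h∉A₂ A₂r })
              (col-swap₂₃ hxr) A₁′h
              (A₂p₀⊆A₁′ r A₂r (⟂-sym (adj-perp {A₀} {A₁} A₀₁ p₀ r A₀p₀
                (subspace-col (basis-subspace a₁) h≢x hxr A₁h A₁x))))

          A₀p₂⊆A₂ : ∀ q → carrier A₀ q → q ⟂ p₂ → carrier A₂ q
          A₀p₂⊆A₂ q A₀q q⟂p₂ = decidable-stable (basis? a₂ q) (A₀A₁⊆A₂ q A₀q (A₀p₂⊆A₁ q A₀q q⟂p₂))

          H : PSet
          H = carrier A₀ ∩ carrier A₂

          -- The point of the line `p₀q` collinear with `p₂` falls into `A₂`, so `H` is a hyperplane
          -- of `A₀` missing `p₀`.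
          project : ∀ q → carrier A₀ q → ¬ (p₀ ≡ q) → Σ[ r ∈ Point ] (H r × Col p₀ q r)
          project q A₀q p₀≢q with meet (basis-singular a₀ p₀ q A₀p₀ A₀q) p₀≢q p₂
          ... | r , p₀qr , p₂⟂r = r , (A₀r , A₀p₂⊆A₂ r A₀r (⟂-sym p₂⟂r)) , p₀qr
            where
            A₀r = subspace-col (basis-subspace a₀) p₀≢q p₀qr A₀p₀ A₀q

          p₀∉A₂ : ¬ carrier A₂ p₀
          p₀∉A₂ A₂p₀ = p₀̸p₂ (basis-singular a₂ p₀ p₂ A₂p₀ A₂p₂)

          hb : Basis H k
          hb = hyperplane-basis a₀
                 (λ p q L p≢q (A₀p , A₂p) (A₀q , A₂q) pL qL r rL →
                   basis-subspace a₀ p q L p≢q A₀p A₀q pL qL r rL ,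
                   basis-subspace a₂ p q L p≢q A₂p A₂q pL qL r rL)
                 (λ _ → proj₁) A₀p₀ (λ (_ , A₂p₀) → p₀∉A₂ A₂p₀) project

          ⟂A₀ : ∀ w → w ⟂ p₀ → (∀ r → H r → w ⟂ r) → (carrier A₀ ᗮ) w
          ⟂A₀ w w⟂p₀ w⟂H x A₀x with p₀ ≟ x
          ... | yes refl = ⟂-sym w⟂p₀
          ... | no p₀≢x with project x A₀x p₀≢x
          ... | r , Hr , p₀xr = ⟂-sym (spread (λ { refl → p₀∉A₂ (proj₂ Hr) })
                                  (col-swap₂₃ p₀xr) w⟂p₀ (w⟂H r Hr))

          C⊆w∷a₀ : ∀ w → ⟨ w ∷ vectors hb ⟩ ⊆ ⟨ w ∷ vectors a₀ ⟩
          C⊆w∷a₀ w = ⟨⟩-least {w ∷ vectors hb} {w ∷ vectors a₀} (∷-⊆ (⟨⟩-∈ w (here refl))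
            (λ r r∈ → ⟨⟩-tail r (proj₁ (spans a₀) r (proj₁ (vectors-⊆ hb r r∈)))))

          -- ⟨w, A₀ ∩ A₂⟩ is the middle vertex of a walk of length two from A₀ to A₃.
          detour : ∀ w y → (carrier A₀ ᗮ) w → ¬ carrier A₀ w → (carrier A₃ ᗮ) y → ¬ carrier A₃ y →
            ⟨ w ∷ vectors hb ⟩ ⊆ ⟨ y ∷ vectors a₃ ⟩ → ¬ (carrier A₃ ≐ ⟨ w ∷ vectors hb ⟩) → ⊥
          detour w y w⟂A₀ w∉A₀ y⟂A₃ y∉A₃ C⊆ A₃≢C = far-¬adj² {A₀} {A₃} far C
            (adj-extend {A₀} {C} w⟂A₀ w∉A₀ (C⊆w∷a₀ w)
              (λ (_ , C⊆A₀) → w∉A₀ (C⊆A₀ w (⟨⟩-∈ w (here refl)))))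
            (adj-sym {A₃} {C} (adj-extend {A₃} {C} y⟂A₃ y∉A₃ C⊆ A₃≢C))
            where
            C = fromBasis (basis-extend hb (λ r (A₀r , _) → w⟂A₀ r A₀r) (λ (A₀w , _) → w∉A₀ A₀w))

          A₃⊈A₀ : ¬ (carrier A₃ ⊆ carrier A₀)
          A₃⊈A₀ A₃⊆A₀ = far-≢ {A₀} {A₃} far (basis-full a₃ a₀ A₃⊆A₀ , A₃⊆A₀)

          -- `A₃` is generated by `H` and any of its points `a` outside `A₀`. If `a` is collinear
          -- with `p₀`, then `A₃` lies in the span of `a` and `A₀` and is adjacent to `A₀`.
          inside : H ⊆ carrier A₃ → ⊥
          inside H⊆A₃ = go (basis-escape a₃ a₀)
            where
            generated : ∀ w → carrier A₃ w → ¬ carrier A₀ w → carrier A₃ ⊆ ⟨ w ∷ vectors hb ⟩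
            generated w A₃w w∉A₀ = basis-full e a₃ (span-⊆ (basis-subspace a₃) (w ∷ vectors hb)
              (clique e) (∷-⊆ A₃w (λ r r∈ → H⊆A₃ r (vectors-⊆ hb r r∈))))
              where
              e = basis-extend hb (λ r Hr → basis-singular a₃ r w (H⊆A₃ r Hr) A₃w) (λ (A₀w , _) → w∉A₀ A₀w)

            -- On the line from `p₀` to the extra point `v`, take `w` collinear with `a`. It is
            -- collinear with `A₀`, and with `A₃` because `a` and `H` generate `A₃`. It is not in
            -- `A₃`: otherwise `w` and `H` would generate `A₃` and make `a` collinear with `p₀`.
            apart : ∀ a → carrier A₃ a → ¬ carrier A₀ a → ¬ (p₀ ⟂ a) →
              ¬ (Σ[ v ∈ Point ] ((carrier A₀ ᗮ) v × ¬ carrier A₀ v))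
            apart a A₃a a∉A₀ p₀̸a (v , v⟂A₀ , v∉A₀) with meet (v⟂A₀ p₀ A₀p₀) (λ { refl → v∉A₀ A₀p₀ }) a
            ... | w , p₀vw , a⟂w = detour w w w⟂A₀ w∉A₀ w⟂A₃ w∉A₃
              (⟨⟩-least {w ∷ vectors hb} {w ∷ vectors a₃} (∷-⊆ (⟨⟩-∈ w (here refl))
                (λ r r∈ → ⟨⟩-tail r (proj₁ (spans a₃) r (H⊆A₃ r (vectors-⊆ hb r r∈))))))
              (λ (_ , C⊆A₃) → w∉A₃ (C⊆A₃ w (⟨⟩-∈ w (here refl))))
              where
              w∉A₀ : ¬ carrier A₀ w
              w∉A₀ A₀w = v∉A₀ (subspace-col (basis-subspace a₀) (λ { refl → p₀̸a (⟂-sym a⟂w) })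
                           (col-swap₂₃ p₀vw) A₀p₀ A₀w)
              w⟂A₀ : (carrier A₀ ᗮ) w
              w⟂A₀ = subspace-col (ᗮ-subspace (carrier A₀)) (λ { refl → v∉A₀ A₀p₀ }) p₀vw
                       (λ r A₀r → basis-singular a₀ r p₀ A₀r A₀p₀) v⟂A₀
              w⟂A₃ : (carrier A₃ ᗮ) w
              w⟂A₃ r A₃r = ⟂-sym (generated a A₃a a∉A₀ r A₃r w
                (∷-ᗮ a⟂w (λ s s∈ → w⟂A₀ s (proj₁ (vectors-⊆ hb s s∈)))))
              w∉A₃ : ¬ carrier A₃ w
              w∉A₃ A₃w = p₀̸a (generated w A₃w w∉A₀ a A₃a p₀
                (∷-ᗮ (⟂-sym (w⟂A₀ p₀ A₀p₀)) (λ s s∈ → basis-singular a₀ s p₀ (proj₁ (vectors-⊆ hb s s∈)) A₀p₀)))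

            go : carrier A₃ ⊆ carrier A₀ ⊎ (Σ[ a ∈ Point ] (carrier A₃ a × ¬ carrier A₀ a)) → ⊥
            go (inj₁ A₃⊆A₀) = A₃⊈A₀ A₃⊆A₀
            go (inj₂ (a , A₃a , a∉A₀)) with p₀ ⟂? a
            ... | no p₀̸a = room (apart a A₃a a∉A₀ p₀̸a)
            ... | yes p₀⟂a = far-¬adj {A₀} {A₃} far (adj-extend {A₀} {A₃}
              (⟂A₀ a (⟂-sym p₀⟂a) (λ r Hr → basis-singular a₃ a r A₃a (H⊆A₃ r Hr))) a∉A₀
              (λ x A₃x → C⊆w∷a₀ a x (generated a A₃a a∉A₀ x A₃x))
              (far-≢ {A₀} {A₃} far))

          outside : ∀ h → H h → ¬ carrier A₃ h → ⊥
          outside h (A₀h , A₂h) h∉A₃ =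
            go (adj-hyperplane {A₂} {A₃} A₂₃ h p₂ A₂h A₂p₂ h∉A₃ h≢p₂) (basis-escape a₃ a₂)
            where
            h≢p₂ : ¬ (h ≡ p₂)
            h≢p₂ refl = p₀̸p₂ (basis-singular a₀ p₀ h A₀p₀ A₀h)
            A₃⊆ : carrier A₃ ⊆ ⟨ h ∷ vectors a₃ ⟩
            A₃⊆ r A₃r = ⟨⟩-tail r (proj₁ (spans a₃) r A₃r)
            A₂⊆ : carrier A₂ ⊆ ⟨ h ∷ vectors a₃ ⟩
            A₂⊆ x A₂x with h ≟ x
            ... | yes refl = ⟨⟩-∈ h (here refl)
            ... | no h≢x with adj-hyperplane {A₂} {A₃} A₂₃ h x A₂h A₂x h∉A₃ h≢x
            ... | r , A₃r , hxr = subspace-col (⟨⟩-subspace (h ∷ vectors a₃)) (λ { refl → h∉A₃ A₃r })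
              (col-swap₂₃ hxr) (⟨⟩-∈ h (here refl)) (A₃⊆ r A₃r)

            -- `w` is taken on the line `uv` of `A₃`, collinear with `p₀` and hence with `A₀`. The
            -- choice of `u` in `A₂` but not in `A₀`, and of `v` not in `A₂`, keeps `w` out of `A₀`:
            -- a point of `A₀` collinear with `p₂` is in `A₂`, and `u` and `w` would put `v` there
            -- as well.
            finish : ∀ u v → carrier A₃ u → Col h p₂ u → carrier A₃ v → ¬ carrier A₂ v → ⊥
            finish u v A₃u hp₂u A₃v v∉A₂
              with meet (basis-singular a₃ u v A₃u A₃v) (λ { refl → v∉A₂ (A₂-line hp₂u) }) p₀
              where
              A₂-line : ∀ {w} → Col h p₂ w → carrier A₂ w
              A₂-line hp₂w = subspace-col (basis-subspace a₂) h≢p₂ hp₂w A₂h A₂p₂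
            ... | w , uvw , p₀⟂w = detour w h
              (⟂A₀ w (⟂-sym p₀⟂w) (λ r (_ , A₂r) → ⟂-sym (adj-perp {A₂} {A₃} A₂₃ r w A₂r A₃w)))
              w∉A₀
              (λ r A₃r → ⟂-sym (adj-perp {A₂} {A₃} A₂₃ h r A₂h A₃r)) h∉A₃
              (⟨⟩-least {w ∷ vectors hb} {h ∷ vectors a₃} (∷-⊆ (A₃⊆ w A₃w)
                (λ r r∈ → A₂⊆ r (proj₂ (vectors-⊆ hb r r∈)))))
              (λ (_ , C⊆A₃) → h∉A₃ (C⊆A₃ h (⟨⟩-tail h (proj₁ (spans hb) h (A₀h , A₂h)))))
              where
              A₂u : carrier A₂ u
              A₂u = subspace-col (basis-subspace a₂) h≢p₂ hp₂u A₂h A₂p₂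
              u∉A₀ : ¬ carrier A₀ u
              u∉A₀ A₀u = p₀̸p₂ (basis-singular a₀ p₀ p₂ A₀p₀
                (subspace-col (basis-subspace a₀) (λ { refl → h∉A₃ A₃u }) (col-swap₂₃ hp₂u) A₀h A₀u))
              A₃w : carrier A₃ w
              A₃w = subspace-col (basis-subspace a₃) (λ { refl → v∉A₂ A₂u }) uvw A₃u A₃v
              w∉A₀ : ¬ carrier A₀ w
              w∉A₀ A₀w = v∉A₂ (subspace-col (basis-subspace a₂) (λ { refl → u∉A₀ A₀w })
                (col-swap₂₃ uvw) A₂u
                (A₀p₂⊆A₂ w A₀w (⟂-sym (adj-perp {A₂} {A₃} A₂₃ p₂ w A₂p₂ A₃w))))

            go : Σ[ u ∈ Point ] (carrier A₃ u × Col h p₂ u) →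
              carrier A₃ ⊆ carrier A₂ ⊎ (Σ[ v ∈ Point ] (carrier A₃ v × ¬ carrier A₂ v)) → ⊥
            go _ (inj₁ A₃⊆A₂) = proj₁ A₂₃ (basis-full a₃ a₂ A₃⊆A₂ , A₃⊆A₂)
            go (u , A₃u , hp₂u) (inj₂ (v , A₃v , v∉A₂)) = finish u v A₃u hp₂u A₃v v∉A₂

          cases : H ⊆ carrier A₃ ⊎ (Σ[ h ∈ Point ] (H h × ¬ carrier A₃ h)) → ⊥
          cases (inj₁ H⊆A₃) = inside H⊆A₃
          cases (inj₂ (h , Hh , h∉A₃)) = outside h Hh h∉A₃

      -- A point `h` of `X` in `Z₂` but not in `Z₁` would settle it: every other point of `X` lies
      -- on a line from `h` to a point of `Z₁`, and both ends are collinear with `B`.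
      perp-through : ∀ {B} (X Z₁ Z₂ : KSub Π k) → Adj X Z₁ → Adj X Z₂ →
        ¬ (carrier Z₁ ≐ carrier Z₂) → ¬ Adj Z₁ Z₂ → Perp (carrier Z₁) (carrier Z₂) →
        Perp (carrier Z₁) B → Perp (carrier Z₂) B → Perp (carrier X) B
      perp-through X Z₁ Z₂ XZ₁ XZ₂ Z₁≢Z₂ ¬Z₁Z₂ Z₁⟂Z₂ Z₁⟂B Z₂⟂B p q Xp Bq = ⟂-stable contra
        where
        z₁ = kbasis Z₁
        z₂ = kbasis Z₂

        via : ∀ Y Z → Adj X Z → Perp (carrier Y) _ → Perp (carrier Z) _ →
          ∀ h → carrier X h → carrier Y h → ¬ carrier Z h → p ⟂ q
        via Y Z XZ Y⟂B Z⟂B h Xh Yh h∉Z with h ≟ p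
        ... | yes refl = Y⟂B p q Yh Bq
        ... | no h≢p with adj-hyperplane {X} {Z} XZ h p Xh Xp h∉Z h≢p
        ... | r , Zr , hpr = ⟂-sym (spread (λ { refl → h∉Z Zr }) (col-swap₂₃ hpr)
                               (⟂-sym (Y⟂B h q Yh Bq)) (⟂-sym (Z⟂B r q Zr Bq)))

        -- If X ∩ Z₁ = X ∩ Z₂ then Z₁ and Z₂ would be adjacent.
        contra : ¬ ¬ (p ⟂ q)
        contra p̸q with basis-escape z₂ z₁
        ... | inj₁ Z₂⊆Z₁ = Z₁≢Z₂ (basis-full z₂ z₁ Z₂⊆Z₁ , Z₂⊆Z₁)
        ... | inj₂ (z , Z₂z , z∉Z₁) = ¬Z₁Z₂ (adj-extend {Z₁} {Z₂}
                (λ r Z₁r → Z₁⟂Z₂ r z Z₁r Z₂z) z∉Z₁ Z₂⊆ Z₁≢Z₂)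
          where
          XZ₂⊆Z₁ : ∀ r → carrier X r → carrier Z₂ r → carrier Z₁ r
          XZ₂⊆Z₁ r Xr Z₂r = decidable-stable (basis? z₁ r)
            (λ r∉Z₁ → p̸q (via Z₂ Z₁ XZ₁ Z₂⟂B Z₁⟂B r Xr Z₂r r∉Z₁))
          Z₂⊆ : carrier Z₂ ⊆ ⟨ z ∷ vectors z₁ ⟩
          Z₂⊆ x Z₂x with z ≟ x
          ... | yes refl = ⟨⟩-∈ z (here refl)
          ... | no z≢x with adj-hyperplane {Z₂} {X} (adj-sym {X} {Z₂} XZ₂) z x Z₂z Z₂x
                              (λ Xz → z∉Z₁ (XZ₂⊆Z₁ z Xz Z₂z)) z≢x
          ... | r , Xr , zxr = subspace-col (⟨⟩-subspace (z ∷ vectors z₁)) (λ { refl → z∉Z₁ Z₁r })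
                  (col-swap₂₃ zxr) (⟨⟩-∈ z (here refl)) (⟨⟩-tail r (proj₁ (spans z₁) r Z₁r))
            where
            Z₁r = XZ₂⊆Z₁ r Xr (subspace-col (basis-subspace z₂) z≢x zxr Z₂z Z₂x)

      -- `4 + k` counts the `suc k` basis vectors of `A` and three points of `B`, each outside the
      -- span of what precedes it. Were `B` used up after none, one or two of them, `A` and `B`
      -- would be equal, adjacent, or joined by a common neighbour.
      far-span : (A B : KSub Π k) → Perp (carrier A) (carrier B) → Far A B →
        Σ[ S ∈ PSet ] Basis S (4 + k)
      far-span A B A⟂B far with basis-escape (kbasis B) (kbasis A)
      ... | inj₁ B⊆A = ⊥-elim (far-≢ {A} {B} far (basis-full (kbasis B) (kbasis A) B⊆A , B⊆A))
      ... | inj₂ (b₁ , Bb₁ , b₁∉A) = second (basis-escape b e₁)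
        where
        a = kbasis A
        b = kbasis B
        ⟂b₁ : (carrier A ᗮ) b₁
        ⟂b₁ r Ar = A⟂B r b₁ Ar Bb₁
        e₁ = basis-extend a ⟂b₁ b₁∉A
        E₁ = ⟨ vectors e₁ ⟩
        ⟂E₁ : ∀ q → carrier B q → (E₁ ᗮ) q
        ⟂E₁ q Bq = ⟨⟩-ᗮ (∷-ᗮ (basis-singular b b₁ q Bb₁ Bq) (λ r r∈ → A⟂B r q (vectors-⊆ a r r∈) Bq))

        third : ∀ b₂ (Bb₂ : carrier B b₂) (b₂∉E₁ : ¬ E₁ b₂) →
          carrier B ⊆ ⟨ b₂ ∷ vectors e₁ ⟩ ⊎ (Σ[ p ∈ Point ] (carrier B p × ¬ ⟨ b₂ ∷ vectors e₁ ⟩ p)) →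
          Σ[ S ∈ PSet ] Basis S (4 + k)
        third b₂ Bb₂ b₂∉E₁ (inj₂ (b₃ , Bb₃ , b₃∉E₂)) = _ , basis-extend e₂
          (⟨⟩-ᗮ (∷-ᗮ (basis-singular b b₂ b₃ Bb₂ Bb₃) (λ r r∈ → ⟂E₁ b₃ Bb₃ r (⟨⟩-∈ r r∈)))) b₃∉E₂
          where e₂ = basis-extend e₁ (⟂E₁ b₂ Bb₂) b₂∉E₁
        -- ⟨b₁, x, A ∩ B⟩ with x in A ∖ B is the middle vertex of a walk of length two.
        third b₂ Bb₂ b₂∉E₁ (inj₁ B⊆E₂) = ⊥-elim (impossible (basis-suc h₁ (Bb₁ , ⟨⟩-∈ b₁ (here refl))) (basis-escape a b))
          where
          e₂ = basis-extend e₁ (⟂E₁ b₂ Bb₂) b₂∉E₁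
          ∩-subspace : ∀ {S T} → IsSubspace S → IsSubspace T → IsSubspace (S ∩ T)
          ∩-subspace S-sub T-sub p q L p≢q (Sp , Tp) (Sq , Tq) pL qL r rL =
            S-sub p q L p≢q Sp Sq pL qL r rL , T-sub p q L p≢q Tp Tq pL qL r rL
          h₁ : Basis (carrier B ∩ E₁) k
          h₁ = hyperplane-basis b (∩-subspace (basis-subspace b) (basis-subspace e₁)) (λ _ → proj₁)
                 Bb₂ (λ (_ , h) → b₂∉E₁ h) project
            where
            project : ∀ q → carrier B q → ¬ (b₂ ≡ q) → Σ[ r ∈ Point ] ((carrier B ∩ E₁) r × Col b₂ q r)
            project q Bq b₂≢q with ⟨∷⟩-line (clique e₂) b₂∉E₁ (B⊆E₂ q Bq) (λ e → b₂≢q (sym e))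
            ... | r , r∈ , b₂qr = r , (subspace-col (basis-subspace b) b₂≢q b₂qr Bb₂ Bq , r∈) , b₂qr
          -- The intersection of `B` with `E₁` has `k` basis vectors and contains `b₁`, so `k` is
          -- positive. Its hyperplane, the intersection of `A` and `B`, has `k - 1`; adding `x` and
          -- `b₁` gives the `k + 1` required of a vertex.
          impossible : Σ[ m ∈ ℕ ] k ≡ suc m →
            carrier A ⊆ carrier B ⊎ (Σ[ p ∈ Point ] (carrier A p × ¬ carrier B p)) → ⊥
          impossible _ (inj₁ A⊆B) = far-≢ {A} {B} far (A⊆B , basis-full a b A⊆B)
          impossible (m , refl) (inj₂ (x , Ax , x∉B)) = far-¬adj² {A} {B} far C
            (adj-extend {A} {C} ⟂b₁ b₁∉A
              (⟨⟩-least {b₁ ∷ x ∷ vectors h₂} {b₁ ∷ vectors a}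
                (∷-⊆ (⟨⟩-∈ b₁ (here refl)) (λ r r∈ → ⟨⟩-tail r (proj₁ (spans a) r (⊆A r r∈)))))
              (λ (_ , C⊆A) → b₁∉A (C⊆A b₁ (⟨⟩-∈ b₁ (here refl)))))
            (adj-sym {B} {C} (adj-extend {B} {C} (λ r Br → ⟂-sym (A⟂B x r Ax Br)) x∉B
              (⟨⟩-least {b₁ ∷ x ∷ vectors h₂} {x ∷ vectors b}
                (∷-⊆ (⟨⟩-tail b₁ (proj₁ (spans b) b₁ Bb₁)) (∷-⊆ (⟨⟩-∈ x (here refl))
                  (λ r r∈ → ⟨⟩-tail r (proj₁ (spans b) r (proj₂ (vectors-⊆ h₂ r r∈)))))))
              (λ (_ , C⊆B) → x∉B (C⊆B x (⟨⟩-tail x (⟨⟩-∈ x (here refl)))))))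
            where
            h₂ : Basis (carrier A ∩ carrier B) m
            h₂ = hyperplane-basis h₁ (∩-subspace (basis-subspace a) (basis-subspace b))
                   (λ r (Ar , Br) → Br , ⟨⟩-tail r (proj₁ (spans a) r Ar))
                   (Bb₁ , ⟨⟩-∈ b₁ (here refl)) (λ (Ab₁ , _) → b₁∉A Ab₁) project
              where
              project : ∀ q → (carrier B ∩ E₁) q → ¬ (b₁ ≡ q) →
                Σ[ r ∈ Point ] ((carrier A ∩ carrier B) r × Col b₁ q r)
              project q (Bq , q∈) b₁≢q
                with ⟨∷⟩-line (clique e₁) (λ h → b₁∉A (proj₂ (spans a) b₁ h)) q∈ (λ e → b₁≢q (sym e))
              ... | r , r∈ , b₁qr = r , (proj₂ (spans a) r r∈ , subspace-col (basis-subspace b) b₁≢q b₁qr Bb₁ Bq) , b₁qr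
            ⊆A : ⟦ x ∷ vectors h₂ ⟧ ⊆ carrier A
            ⊆A = ∷-⊆ Ax (λ r r∈ → proj₁ (vectors-⊆ h₂ r r∈))
            xh₂ = basis-extend h₂ (λ r (Ar , _) → basis-singular a r x Ar Ax) (λ (_ , Bx) → x∉B Bx)
            C : KSub Π k
            C = fromBasis (basis-extend xh₂ (⟨⟩-ᗮ (λ r r∈ → ⟂b₁ r (⊆A r r∈)))
                  (λ h → b₁∉A (span-⊆ (basis-subspace a) (x ∷ vectors h₂) (clique xh₂) ⊆A b₁ h)))

        second : carrier B ⊆ E₁ ⊎ (Σ[ p ∈ Point ] (carrier B p × ¬ E₁ p)) → Σ[ S ∈ PSet ] Basis S (4 + k)
        second (inj₁ B⊆E₁) = ⊥-elim (far-¬adj {A} {B} far (adj-extend {A} {B} ⟂b₁ b₁∉A B⊆E₁ (far-≢ {A} {B} far)))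
        second (inj₂ (b₂ , Bb₂ , b₂∉E₁)) =
          third b₂ Bb₂ b₂∉E₁ (basis-escape b (basis-extend e₁ (⟂E₁ b₂ Bb₂) b₂∉E₁))

-- Maximal singular subspaces and the rank

rank-line : (Π : PolarSpace) {n : ℕ} → HasRank Π n → 2 ≤ n → PolarSpace.Line Π
rank-line Π ((S , S-max) , dims) 2≤n with dims S S-max
... | (c , (sub , step) , _) , _ with step 0 (≤-trans (s≤s z≤n) 2≤n) | step 1 2≤n
... | _ , p , c₁p , _ | _ , q , c₂q , q∉c₁
  with proj₂ (proj₁ S-max) p q (proj₂ (sub 1 (≤-trans (s≤s z≤n) 2≤n)) p c₁p) (proj₂ (sub 2 2≤n) q c₂q)
... | inj₁ refl = ⊥-elim (q∉c₁ c₁p)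
... | inj₂ (L , _) = L

module Maximal (Π : PolarSpace) (L₀ : PolarSpace.Line Π) where
  open PolarSpace Π
  open Polar Π
  open WithLine L₀
  open Basis

  -- Adjoining `q` to `S` leaves it singular, and the double perp of the result is a singular
  -- subspace containing `S`.
  maximal-closed : ∀ {S} → IsMaximalSingular S → (S ᗮ) ⊆ S
  maximal-closed {S} ((_ , sing) , max) q S⟂q =
    max (T ᗮ ᗮ) (ᗮ-subspace (T ᗮ) , ᗮᗮ-singular T-sing) (λ r Sr → ⊆ᗮᗮ {T} r (inj₁ Sr)) q (⊆ᗮᗮ {T} q (inj₂ refl))
    where
    T : PSet
    T r = S r ⊎ r ≡ q
    T-sing : IsSingular T
    T-sing r s (inj₁ Sr) (inj₁ Ss) = sing r s Sr Ss
    T-sing r _ (inj₁ Sr) (inj₂ refl) = S⟂q r Sr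
    T-sing _ s (inj₂ refl) (inj₁ Ss) = ⟂-sym (S⟂q s Ss)
    T-sing _ _ (inj₂ refl) (inj₂ refl) = inj₁ refl

  self-perp-maximal : ∀ {A} → IsSingular (A ᗮ) → IsSingular A → IsMaximalSingular (A ᗮ)
  self-perp-maximal {A} sing A-sing = (ᗮ-subspace A , sing) ,
    λ T (_ , T-sing) Aᗮ⊆T t Tt r Ar → T-sing r t (Aᗮ⊆T r (λ s As → A-sing s r As Ar)) Tt

  pivot : PSet → Point → PSet
  pivot S p r = r ≡ p ⊎ (S r × r ⟂ p)

  -- The span of p and S ∩ p^⊥, for S a maximal singular subspace.
  infixl 6 _◁_
  _◁_ : PSet → Point → PSet
  S ◁ p = pivot S p ᗮ

  module _ {S : PSet} (S-max : IsMaximalSingular S) where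

    private
      S-sub = proj₁ (proj₁ S-max)
      S-sing = proj₂ (proj₁ S-max)

    ◁-project : ∀ {p s y} → S s → ¬ (s ⟂ p) → S y → ¬ (s ≡ y) →
      Σ[ e ∈ Point ] (S e × e ⟂ p × Col s y e)
    ◁-project {p} {s} {y} Ss s̸p Sy s≢y with meet (S-sing s y Ss Sy) s≢y p
    ... | e , sye , p⟂e = e , subspace-col S-sub s≢y sye Ss Sy , ⟂-sym p⟂e , sye

    -- The point `r` of the line `pq` collinear with `s` is also collinear with all points of `S`
    -- collinear with `p`. These and `s` generate `S`, so maximality puts `r` into `S`.
    ◁-line : ∀ {p s q} → S s → ¬ (s ⟂ p) → (S ◁ p) q → ¬ (p ≡ q) →
      Σ[ r ∈ Point ] (S r × r ⟂ p × Col p q r)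
    ◁-line {p} {s} {q} Ss s̸p q∈ p≢q with meet (q∈ p (inj₁ refl)) p≢q s
    ... | r , pqr , s⟂r = r , maximal-closed S-max r S⟂r , ⟂-sym (col-⟂ (col-swap₂₃ pqr)) , pqr
      where
      r⟂ : ∀ e → S e → e ⟂ p → e ⟂ r
      r⟂ e Se e⟂p = spread p≢q pqr e⟂p (q∈ e (inj₂ (Se , e⟂p)))
      S⟂r : ∀ y → S y → y ⟂ r
      S⟂r y Sy with s ≟ y
      ... | yes refl = s⟂r
      ... | no s≢y with ◁-project Ss s̸p Sy s≢y
      ... | e , Se , e⟂p , sye = ⟂-sym (spread (λ { refl → s̸p e⟂p }) (col-swap₂₃ sye)
                                   (⟂-sym s⟂r) (⟂-sym (r⟂ e Se e⟂p)))

    pivot-singular : ∀ {p} → IsSingular (pivot S p)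
    pivot-singular _ _ (inj₁ refl) (inj₁ refl) = inj₁ refl
    pivot-singular _ _ (inj₁ refl) (inj₂ (_ , r⟂p)) = ⟂-sym r⟂p
    pivot-singular _ _ (inj₂ (_ , r⟂p)) (inj₁ refl) = r⟂p
    pivot-singular r s (inj₂ (Sr , _)) (inj₂ (Ss , _)) = S-sing r s Sr Ss

    -- No basis of `S` is at hand to decide whether `p` is collinear with all of `S`. Stability of
    -- collinearity allows both cases to be argued nevertheless.
    ◁-singular : ∀ {p} → IsSingular (S ◁ p)
    ◁-singular {p} q q′ q∈ q′∈ = ⟂-stable λ q̸q′ → q̸q′ (within (λ s Ss → ⟂-stable λ s̸p → q̸q′ (beyond Ss s̸p)))
      where
      beyond : ∀ {s} → S s → ¬ (s ⟂ p) → q ⟂ q′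
      beyond Ss s̸p with p ≟ q
      ... | yes refl = q′∈ p (inj₁ refl)
      ... | no p≢q with ◁-line Ss s̸p q∈ p≢q
      ... | r , Sr , r⟂p , pqr = ⟂-sym (spread (λ { refl → s̸p (S-sing _ p Ss Sr) }) (col-swap₂₃ pqr)
                                   (⟂-sym (q′∈ p (inj₁ refl))) (⟂-sym (q′∈ r (inj₂ (Sr , r⟂p)))))
      within : (∀ s → S s → s ⟂ p) → q ⟂ q′
      within S⟂p = S-sing q q′ (maximal-closed S-max q (λ r Sr → q∈ r (inj₂ (Sr , S⟂p r Sr))))
                               (maximal-closed S-max q′ (λ r Sr → q′∈ r (inj₂ (Sr , S⟂p r Sr))))

    ◁-maximal : ∀ {p} → IsMaximalSingular (S ◁ p)
    ◁-maximal = self-perp-maximal ◁-singular pivot-singular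

    ◁-∋ : ∀ {p} → (S ◁ p) p
    ◁-∋ {p} r r∈ = pivot-singular r p r∈ (inj₁ refl)

    ◁-⊇ : ∀ {p q} → S q → q ⟂ p → (S ◁ p) q
    ◁-⊇ {p} {q} Sq q⟂p r r∈ = pivot-singular r q r∈ (inj₂ (Sq , q⟂p))

    ◁-basis : ∀ {p s m} → Basis S (suc m) → S s → ¬ (s ⟂ p) → Basis (S ∩ (S ◁ p)) m
    ◁-basis {p} {s} b Ss s̸p = hyperplane-basis b
      (λ a c L a≢c (Sa , a∈) (Sc , c∈) aL cL r rL →
        S-sub a c L a≢c Sa Sc aL cL r rL , ᗮ-subspace (pivot S p) a c L a≢c a∈ c∈ aL cL r rL)
      (λ _ → proj₁) Ss (λ (_ , s∈) → s̸p (⟂-sym (s∈ p (inj₁ refl))))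
      λ q Sq s≢q → let (e , Se , e⟂p , sqe) = ◁-project Ss s̸p Sq s≢q in e , (Se , ◁-⊇ Se e⟂p) , sqe

    maximal-∌ : ∀ {m p} → Basis S m → ¬ S p → Σ[ s ∈ Point ] (S s × ¬ (s ⟂ p))
    maximal-∌ {p = p} b p∉ with decide-⊆ᗮ (vectors b) p
    ... | inj₁ h = ⊥-elim (p∉ (maximal-closed S-max p (λ r Sr → ⟨⟩-ᗮ h r (proj₁ (spans b) r Sr))))
    ... | inj₂ (s , s∈ , s̸p) = s , vectors-⊆ b s s∈ , s̸p

  -- A point `r` of `S ◁ q` other than `q` lies on a line `qe` with `e` in `S` and collinear with
  -- `q`. If `r` is collinear with `p`, so is `e`, which therefore belongs to `S ◁ p` and to the
  -- pivot for `q`.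
  ◁-comm-⊆ : ∀ {S p q s} → IsMaximalSingular S → p ⟂ q → S s → ¬ (s ⟂ q) → (S ◁ p ◁ q) ⊆ (S ◁ q ◁ p)
  ◁-comm-⊆ {S} {p} {q} {s} S-max p⟂q Ss s̸q t t∈ = perp
    where
    perp : ∀ r → pivot (S ◁ q) p r → r ⟂ t
    perp _ (inj₁ refl) = t∈ p (inj₂ (◁-∋ S-max , p⟂q))
    perp r (inj₂ (r∈ , r⟂p)) with q ≟ r
    ... | yes refl = t∈ q (inj₁ refl)
    ... | no q≢r with ◁-line S-max Ss s̸q r∈ q≢r
    ... | e , Se , e⟂q , qre = ⟂-sym (spread (λ { refl → s̸q (proj₂ (proj₁ S-max) s q Ss Se) }) (col-swap₂₃ qre)
                                 (⟂-sym (t∈ q (inj₁ refl))) (⟂-sym (t∈ e (inj₂ (◁-⊇ S-max Se e⟂p , e⟂q)))))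
      where
      e⟂p : e ⟂ p
      e⟂p = ⟂-sym (spread q≢r qre p⟂q (⟂-sym r⟂p))

  -- A given maximal subspace is turned towards the points one at a time; those already reached
  -- survive because they are collinear with the new one.
  maximal-⊇ : ∀ ps → Clique ps → Σ[ S ∈ PSet ] IsMaximalSingular S →
    Σ[ S ∈ PSet ] (IsMaximalSingular S × ⟦ ps ⟧ ⊆ S)
  maximal-⊇ [] cl (S , S-max) = S , S-max , λ _ ()
  maximal-⊇ (p ∷ ps) cl start with maximal-⊇ ps (clique-tail cl) start
  ... | S , S-max , ps⊆S = S ◁ p , ◁-maximal S-max , ∷-⊆ (◁-∋ S-max)
          (λ r r∈ → ◁-⊇ S-max (ps⊆S r r∈) (cl r p (there r∈) (here refl)))

  module Rank {n : ℕ} (rank : HasRank Π n) where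

    maximal-basis : ∀ {S} → IsMaximalSingular S → Basis S n
    maximal-basis {S} S-max = dim→basis (proj₁ S-max) (proj₂ rank S S-max)

    basis-≤-rank : ∀ {A m} → Basis A m → m ≤ n
    basis-≤-rank b with maximal-⊇ (vectors b) (clique b) (proj₁ rank)
    ... | S , S-max , vs⊆S = basis-≤ b (maximal-basis S-max) (basis-span b (proj₁ (proj₁ S-max)) vs⊆S)

    -- Without such a point `A` would be maximal, with fewer than `n` basis vectors. The argument
    -- produces no witness, hence the double negation.
    basis-room : ∀ {A m} → Basis A m → m < n → ¬ ¬ (Σ[ v ∈ Point ] ((A ᗮ) v × ¬ A v))
    basis-room {A} {m} b m<n none = 1+n≰n (≤-trans m<n (basis-≤ (maximal-basis A-max) b (λ _ h → h)))
      where
      A-max : IsMaximalSingular A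
      A-max = (basis-subspace b , basis-singular b) , λ T (_ , T-sing) A⊆T t Tt →
        decidable-stable (basis? b t) (λ t∉A → none (t , (λ r Ar → T-sing r t (A⊆T r Ar) Tt) , t∉A))

-- Quadrangles and geodesics in the dual polar graph

module Dual (Π : PolarSpace) (L₀ : PolarSpace.Line Π) {m : ℕ} (rank : HasRank Π (suc m)) where
  open PolarSpace Π
  open Polar Π
  open WithLine L₀
  open Basis
  open Maximal Π L₀
  open Rank rank
  open MaxSub

  private
    Δ : Graph
    Δ = DualPolarGraph Π (suc m)

  open Graph Δ using (Adj)

  mbasis : (x : MaxSub Π) → Basis (carrier x) (suc m)
  mbasis x = maximal-basis (maximal x)

  msub : (x : MaxSub Π) → IsSubspace (carrier x)
  msub x = proj₁ (proj₁ (maximal x))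

  msing : (x : MaxSub Π) → IsSingular (carrier x)
  msing x = proj₂ (proj₁ (maximal x))

  infixl 6 _▹_
  _▹_ : MaxSub Π → Point → MaxSub Π
  x ▹ p = maxsub (carrier x ◁ p) (◁-maximal (maximal x))

  adj-basis : ∀ x y → Adj x y → Basis (carrier x ∩ carrier y) m
  adj-basis x y = dim→basis
    ( (λ p q L p≢q (xp , yp) (xq , yq) pL qL r rL →
        msub x p q L p≢q xp xq pL qL r rL , msub y p q L p≢q yp yq pL qL r rL)
    , (λ p q (xp , _) (xq , _) → msing x p q xp xq))

  adj-comm : ∀ x y → Adj x y → Adj y x
  adj-comm x y xy = basis→dim (basis-≐ ((λ _ (a , b) → b , a) , (λ _ (a , b) → b , a)) (adj-basis x y xy))

  adj-▹ : ∀ x {p s} → carrier x s → ¬ (s ⟂ p) → Adj x (x ▹ p)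
  adj-▹ x xs s̸p = basis→dim (◁-basis (maximal x) (mbasis x) xs s̸p)

  adj-meets : ∀ x c {a b} → Adj x c → carrier x a → carrier x b → ¬ (a ≡ b) →
    Σ[ r ∈ Point ] (carrier c r × ⟨ a ∷ b ∷ [] ⟩ r)
  adj-meets x c {a} {b} xc xa xb a≢b with basis? (mbasis c) b
  ... | yes cb = b , cb , ⟨⟩-∈ b (there (here refl))
  ... | no b∉c with basis-hyperplane (mbasis x) (adj-basis x c xc) (λ _ → proj₁) b a xb xa
                      (λ (_ , cb) → b∉c cb) (λ e → a≢b (sym e))
  ... | r , (_ , cr) , bar = r , cr , subspace-col (⟨⟩-subspace (a ∷ b ∷ [])) (λ e → a≢b (sym e)) bar
                               (⟨⟩-∈ b (there (here refl))) (⟨⟩-∈ a (here refl))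

  -- `z` acts as a functional vanishing on `ps` but not at `p`, so a point of the span on which it
  -- vanishes has no component along `p`.
  peel : ∀ {p ps z r} → Clique (p ∷ ps) → (⟦ ps ⟧ ᗮ) z → ¬ (p ⟂ z) → ⟨ p ∷ ps ⟩ r → r ⟂ z → ⟨ ps ⟩ r
  peel {p} {ps} {z} {r} cl ps⟂z p̸z r∈ r⟂z with r ≟ p
  ... | yes refl = ⊥-elim (p̸z r⟂z)
  ... | no r≢p with ⟨∷⟩-line cl (λ h → p̸z (⟂-sym (h z ps⟂z))) r∈ r≢p
  ... | e , e∈ , pre with r ≟ e
  ... | yes refl = e∈
  ... | no r≢e = ⊥-elim (p̸z (⟂-sym (spread r≢e (col-rot pre) (⟂-sym r⟂z) (e∈ z ps⟂z))))

  []-ᗮ : ∀ {z} → (⟦ [] ⟧ ᗮ) z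
  []-ᗮ _ ()

  -- The aᵢ span a plane of x disjoint from y, whereas a walk of length at most two from x to y
  -- would make every plane of x meet y.
  far : ∀ x y {a₁ a₂ a₃ b₁ b₂ b₃} →
    carrier x a₁ → carrier x a₂ → carrier x a₃ → carrier y b₁ → carrier y b₂ → carrier y b₃ →
    ¬ (a₁ ⟂ b₁) → a₂ ⟂ b₁ → a₃ ⟂ b₁ → a₁ ⟂ b₂ → ¬ (a₂ ⟂ b₂) → a₃ ⟂ b₂ → ¬ (a₃ ⟂ b₃) →
    ∀ j → j < 3 → ¬ Walk Δ x y j
  far x y {a₁} {a₂} {a₃} {b₁} {b₂} {b₃} xa₁ xa₂ xa₃ yb₁ yb₂ yb₃ a₁̸b₁ a₂⟂b₁ a₃⟂b₁ a₁⟂b₂ a₂̸b₂ a₃⟂b₂ a₃̸b₃ = walks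
    where
    cl : Clique (a₁ ∷ a₂ ∷ a₃ ∷ [])
    cl = clique-⊆ (∷-⊆ xa₁ (∷-⊆ xa₂ (∷-⊆ xa₃ (λ _ ())))) (msing x)
    cl₂₃ = clique-tail cl
    cl₃ = clique-tail cl₂₃

    -- A common point is collinear with every `bⱼ`; peeling with `b₁`, `b₂`, `b₃` in turn removes
    -- `a₁`, `a₂`, `a₃`.
    disjoint : ∀ r → carrier y r → ¬ ⟨ a₁ ∷ a₂ ∷ a₃ ∷ [] ⟩ r
    disjoint r yr r∈ = ⟨[]⟩-empty (peel cl₃ []-ᗮ a₃̸b₃
      (peel cl₂₃ (∷-ᗮ a₃⟂b₂ []-ᗮ) a₂̸b₂
        (peel cl (∷-ᗮ a₂⟂b₁ (∷-ᗮ a₃⟂b₁ []-ᗮ)) a₁̸b₁ r∈ (msing y r b₁ yr yb₁))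
        (msing y r b₂ yr yb₂))
      (msing y r b₃ yr yb₃))

    a₁≢a₂ : ¬ (a₁ ≡ a₂)
    a₁≢a₂ refl = a₁̸b₁ a₂⟂b₁
    a₁≢a₃ : ¬ (a₁ ≡ a₃)
    a₁≢a₃ refl = a₁̸b₁ a₃⟂b₁
    a₂≢a₃ : ¬ (a₂ ≡ a₃)
    a₂≢a₃ refl = a₂̸b₂ a₃⟂b₂

    ∈₁ : ⟨ a₁ ∷ a₂ ∷ a₃ ∷ [] ⟩ a₁
    ∈₁ = ⟨⟩-∈ a₁ (here refl)
    ∈₂ : ⟨ a₁ ∷ a₂ ∷ a₃ ∷ [] ⟩ a₂
    ∈₂ = ⟨⟩-∈ a₂ (there (here refl))
    ∈₃ : ⟨ a₁ ∷ a₂ ∷ a₃ ∷ [] ⟩ a₃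
    ∈₃ = ⟨⟩-∈ a₃ (there (there (here refl)))

    pair-⊆ : ∀ {a b} → ⟨ a₁ ∷ a₂ ∷ a₃ ∷ [] ⟩ a → ⟨ a₁ ∷ a₂ ∷ a₃ ∷ [] ⟩ b →
      ⟨ a ∷ b ∷ [] ⟩ ⊆ ⟨ a₁ ∷ a₂ ∷ a₃ ∷ [] ⟩
    pair-⊆ {a} {b} a∈ b∈ = ⟨⟩-least {a ∷ b ∷ []} {a₁ ∷ a₂ ∷ a₃ ∷ []} (∷-⊆ a∈ (∷-⊆ b∈ (λ _ ())))

    two-steps : ∀ c d {u v} → Adj c d → (∀ r → carrier d r → carrier y r) → carrier c u → carrier c v →
      ⟨ a₁ ∷ a₂ ∷ a₃ ∷ [] ⟩ u → ⟨ a₁ ∷ a₂ ∷ a₃ ∷ [] ⟩ v → ¬ (u ≡ v) → ⊥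
    two-steps c d cd d⊆y cu cv u∈ v∈ u≢v with adj-meets c d cd cu cv u≢v
    ... | r , dr , r∈ = disjoint r (d⊆y r dr) (pair-⊆ u∈ v∈ r r∈)

    walks : ∀ j → j < 3 → ¬ Walk Δ x y j
    walks 0 _ (lift (x⊆y , _)) = a₁̸b₁ (msing y a₁ b₁ (x⊆y a₁ xa₁) yb₁)
    walks 1 _ (c , xc , lift (c⊆y , _)) with adj-meets x c xc xa₁ xa₂ a₁≢a₂
    ... | r , cr , r∈ = disjoint r (c⊆y r cr) (pair-⊆ ∈₁ ∈₂ r r∈)
    -- `c` meets every line of the plane, and a second point different from `u` is needed. If `u` is
    -- not collinear with `b₁`, the line `a₂a₃` avoids it. Otherwise `u` is `a₂`, and the line
    -- `a₁a₃`, all collinear with `b₂`, avoids it.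
    walks 2 _ (c , xc , d , cd , lift (d⊆y , _)) with adj-meets x c xc xa₁ xa₂ a₁≢a₂
    ... | u , cu , u∈ with u ⟂? b₁
    ... | no u̸b₁ with adj-meets x c xc xa₂ xa₃ a₂≢a₃
    ... | v , cv , v∈ = two-steps c d cd d⊆y cu cv (pair-⊆ ∈₁ ∈₂ u u∈) (pair-⊆ ∈₂ ∈₃ v v∈)
            λ { refl → u̸b₁ (⟂-sym (v∈ b₁ (∷-ᗮ a₂⟂b₁ (∷-ᗮ a₃⟂b₁ []-ᗮ)))) }
    walks 2 _ (c , xc , d , cd , lift (d⊆y , _)) | u , cu , u∈ | yes u⟂b₁ with adj-meets x c xc xa₁ xa₃ a₁≢a₃
    ... | v , cv , v∈ = two-steps c d cd d⊆y cu cv (pair-⊆ ∈₁ ∈₂ u u∈) (pair-⊆ ∈₁ ∈₃ v v∈)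
            λ { refl → ⟨[]⟩-empty (peel cl₂ []-ᗮ a₂̸b₂ (peel cl₁₂ (∷-ᗮ a₂⟂b₁ []-ᗮ) a₁̸b₁ u∈ u⟂b₁)
                  (⟂-sym (v∈ b₂ (∷-ᗮ a₁⟂b₂ (∷-ᗮ a₃⟂b₂ []-ᗮ))))) }
      where
      cl₁₂ : Clique (a₁ ∷ a₂ ∷ [])
      cl₁₂ = clique-⊆ (∷-⊆ xa₁ (∷-⊆ xa₂ (λ _ ()))) (msing x)
      cl₂ = clique-tail cl₁₂
    walks (suc (suc (suc _))) (s≤s (s≤s (s≤s ())))

  -- Here x ▹ p and x ▹ q are neighbours of x at distance two.
  record Quad (x : MaxSub Π) : Set where
    field
      p q s t : Point
      p⟂q : p ⟂ q
      xs : carrier x s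
      xt : carrier x t
      s⟂p : s ⟂ p
      s̸q : ¬ (s ⟂ q)
      t⟂q : t ⟂ q
      t̸p : ¬ (t ⟂ p)

  module _ {x : MaxSub Π} (Q : Quad x) where
    open Quad Q

    quad-common : Adj (x ▹ p ▹ q) (x ▹ q)
    quad-common = adj-comm (x ▹ q) (x ▹ p ▹ q) (basis→dim (basis-≐
      ( (λ r (r∈ , r∈′) → r∈ , ◁-comm-⊆ (maximal x) (⟂-sym p⟂q) xt t̸p r r∈′)
      , (λ r (r∈ , r∈′) → r∈ , ◁-comm-⊆ (maximal x) p⟂q xs s̸q r r∈′))
      (adj-basis (x ▹ q) (x ▹ q ▹ p) (adj-▹ (x ▹ q) {p} {t} (◁-⊇ (maximal x) xt t⟂q) t̸p))))

    -- The two neighbours of `x` meet inside `x`. If adjacent, their intersection would have as many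
    -- basis vectors as that of `x` and `x ▹ p`, hence equal it and contain `s`; but `s` is not
    -- collinear with `q`.
    quad-¬adj : ¬ Adj (x ▹ p) (x ▹ q)
    quad-¬adj zz = s̸q (⟂-sym (proj₂ (basis-full (adj-basis (x ▹ p) (x ▹ q) zz)
        (◁-basis (maximal x) (mbasis x) xt t̸p) (λ w w∈ → in-x w w∈ , proj₁ w∈)
        s (xs , ◁-⊇ (maximal x) xs s⟂p)) q (inj₁ refl)))
      where
      in-x : ∀ w → (carrier (x ▹ p) ∩ carrier (x ▹ q)) w → carrier x w
      in-x w (w∈p , w∈q) = maximal-closed (maximal x) w x⟂w
        where
        x⟂w : ∀ v → carrier x v → v ⟂ w
        x⟂w v xv with s ≟ v
        ... | yes refl = w∈p s (inj₂ (xs , s⟂p))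
        ... | no s≢v with ◁-project (maximal x) xs s̸q xv s≢v
        ... | e , xe , e⟂q , sve = ⟂-sym (spread (λ { refl → s̸q e⟂q }) (col-swap₂₃ sve)
                (⟂-sym (w∈p s (inj₂ (xs , s⟂p)))) (⟂-sym (w∈q e (inj₂ (xe , e⟂q)))))

    quad-≢ : ¬ (carrier (x ▹ p) ⊆ carrier (x ▹ q))
    quad-≢ h = s̸q (⟂-sym (h s (◁-⊇ (maximal x) xs s⟂p) q (inj₁ refl)))

    quad-x≢ : ¬ (carrier (x ▹ p ▹ q) ⊆ carrier x)
    quad-x≢ h = t̸p (msing x t p xt (h p (◁-⊇ (◁-maximal (maximal x)) (◁-∋ (maximal x)) p⟂q)))

    module _ (2≤m : 2 ≤ m) where

      abstract
        -- This is where rank at least three enters: `x` has a point `e` off the line `st`.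
        -- Projecting it from `t` makes it collinear with `p`; projecting then from `s`, which is
        -- itself collinear with `p`, makes it collinear with `q` as well.
        quad-third : Σ[ u ∈ Point ] (carrier x u × u ⟂ p × u ⟂ q)
        quad-third = go (escape (mbasis x) (⟨⟩-subspace (s ∷ t ∷ [])) (⟨⟩? st))
          where
          st : Clique (s ∷ t ∷ [])
          st = clique-⊆ (∷-⊆ xs (∷-⊆ xt (λ _ ()))) (msing x)

          from : ∀ e → carrier x e → ¬ ⟨ s ∷ t ∷ [] ⟩ e → Σ[ u ∈ Point ] (carrier x u × u ⟂ p × u ⟂ q)
          from e xe e∉ with ◁-project (maximal x) xt t̸p xe (λ { refl → e∉ (⟨⟩-∈ e (there (here refl))) })
          ... | e′ , xe′ , e′⟂p , tee′ = second (◁-project (maximal x) xs s̸q xe′ s≢e′)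
            where
            s≢e′ : ¬ (s ≡ e′)
            s≢e′ refl = e∉ (subspace-col (⟨⟩-subspace (s ∷ t ∷ [])) (λ { refl → t̸p s⟂p }) (col-swap₂₃ tee′)
                          (⟨⟩-∈ t (there (here refl))) (⟨⟩-∈ s (here refl)))
            second : Σ[ u ∈ Point ] (carrier x u × u ⟂ q × Col s e′ u) →
              Σ[ u ∈ Point ] (carrier x u × u ⟂ p × u ⟂ q)
            second (u , xu , u⟂q , se′u) =
              u , xu , ⟂-sym (spread s≢e′ se′u (⟂-sym s⟂p) (⟂-sym e′⟂p)) , u⟂q

          go : carrier x ⊆ ⟨ s ∷ t ∷ [] ⟩ ⊎ (Σ[ e ∈ Point ] (carrier x e × ¬ ⟨ s ∷ t ∷ [] ⟩ e)) →
            Σ[ u ∈ Point ] (carrier x u × u ⟂ p × u ⟂ q)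
          go (inj₁ x⊆) = ⊥-elim (1+n≰n (≤-trans (s≤s 2≤m) (≤-trans (≤-reflexive (sym (length≡ (mbasis x))))
            (indep-≤ {ps = s ∷ t ∷ []} st (indep (mbasis x)) (λ r r∈ → x⊆ r (vectors-⊆ (mbasis x) r r∈))))))
          go (inj₂ (e , xe , e∉)) = from e xe e∉

        -- `v` is collinear with `t` and `q` but not with `u`. Then `p`, `s`, `u` in `x ▹ p` and
        -- `t`, `q`, `v` in `x ▹ q ▹ v` show the pattern that `far` asks for.
        quad-far : Σ[ v ∈ Point ] (Adj (x ▹ q) (x ▹ q ▹ v) × Dist Δ (x ▹ p) (x ▹ q ▹ v) 3)
        quad-far with quad-third
        ... | u , xu , u⟂p , u⟂q with separate (t ∷ q ∷ []) u cl
          where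
          cl : Clique (u ∷ t ∷ q ∷ [])
          cl = clique-⊆ (∷-⊆ (◁-⊇ (maximal x) xu u⟂q) (∷-⊆ (◁-⊇ (maximal x) xt t⟂q)
                 (∷-⊆ (◁-∋ (maximal x)) (λ _ ())))) (msing (x ▹ q))
        ... | inj₁ u∈ = ⊥-elim (⟨[]⟩-empty
                (peel {q} {[]} {s} (clique-tail cl) []-ᗮ (λ h → s̸q (⟂-sym h))
                  (peel cl (∷-ᗮ (⟂-sym p⟂q) []-ᗮ) t̸p u∈ u⟂p) (msing x u s xu xs)))
          where
          cl : Clique (t ∷ q ∷ [])
          cl = clique-⊆ (∷-⊆ (◁-⊇ (maximal x) xt t⟂q) (∷-⊆ (◁-∋ (maximal x)) (λ _ ()))) (msing (x ▹ q))
        ... | inj₂ (v , ⟂v , v̸u) = v , adj ,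
              ( (x , adj-comm x (x ▹ p) (adj-▹ x xt t̸p) , x ▹ q , adj-▹ x xs s̸q , x ▹ q ▹ v , adj
                , lift ((λ _ h → h) , (λ _ h → h)))
              , far (x ▹ p) (x ▹ q ▹ v) {p} {s} {u} {t} {q} {v}
                  (◁-∋ mx) (◁-⊇ mx xs s⟂p) (◁-⊇ mx xu u⟂p)
                  (◁-⊇ (◁-maximal mx) (◁-⊇ mx xt t⟂q) (⟂v t (here refl)))
                  (◁-⊇ (◁-maximal mx) (◁-∋ mx) (⟂v q (there (here refl))))
                  (◁-∋ (◁-maximal mx))
                  (λ h → t̸p (⟂-sym h)) (msing x s t xs xt) (msing x u t xu xt)
                  p⟂q s̸q u⟂q (λ h → v̸u (⟂-sym h)))
          where
          mx : IsMaximalSingular (carrier x)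
          mx = maximal x
          adj : Adj (x ▹ q) (x ▹ q ▹ v)
          adj = adj-▹ (x ▹ q) {v} {u} (◁-⊇ mx xu u⟂q) (λ h → v̸u (⟂-sym h))

  singleton : ∀ {p q} → ⟨ q ∷ [] ⟩ p → p ≡ q
  singleton {p} {q} p∈ with p ≟ q
  ... | yes e = e
  ... | no p≢q with ⟨∷⟩-line (clique-∷ {q} {[]} (λ _ ()) (λ _ _ ())) ⟨[]⟩-empty p∈ p≢q
  ... | _ , r∈ , _ = ⊥-elim (⟨[]⟩-empty r∈)

  -- `separate` yields `p` collinear with `s` only and `z` collinear with `t` only, but `p` and `z`
  -- may fail to be collinear. So `z` is replaced by the point of the line `tz` collinear with `p`.
  quad-exists : ∀ x {s t} → carrier x s → carrier x t → ¬ (s ≡ t) → Quad x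
  quad-exists x {s} {t} xs xt s≢t with separate (s ∷ []) t ts | separate (t ∷ []) s (clique-⊆ (∷-⊆ xs (∷-⊆ xt (λ _ ()))) (msing x))
    where
    ts : Clique (t ∷ s ∷ [])
    ts = clique-⊆ (∷-⊆ xt (∷-⊆ xs (λ _ ()))) (msing x)
  ... | inj₁ t∈ | _ = ⊥-elim (s≢t (sym (singleton t∈)))
  ... | _ | inj₁ s∈ = ⊥-elim (s≢t (singleton s∈))
  ... | inj₂ (p , ⟂p , p̸t) | inj₂ (z , ⟂z , z̸s)
    with meet (⟂z t (here refl)) (λ { refl → z̸s (msing x z s xt xs) }) p
  ... | q , tzq , p⟂q = record
    { p⟂q = p⟂q ; xs = xs ; xt = xt ; s⟂p = ⟂p s (here refl)
    ; s̸q = λ s⟂q → z̸s (⟂-sym (spread (λ { refl → p̸t p⟂q }) (col-swap₂₃ tzq) (msing x s t xs xt) s⟂q))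
    ; t⟂q = col-⟂ (col-swap₂₃ tzq) ; t̸p = λ h → p̸t (⟂-sym h) }

-- Perpendicularity of the images

module Embedding
  (Π′ Π : PolarSpace) (L′ : PolarSpace.Line Π′) (L : PolarSpace.Line Π) {m n k : ℕ}
  (rank′ : HasRank Π′ (suc m)) (2≤m : 2 ≤ m) (rank : HasRank Π n) (k+2≤n : k + 2 ≤ n)
  (f : MaxSub Π′ → KSub Π k)
  (f-emb : Is3Embedding (DualPolarGraph Π′ (suc m)) (GrassmannGraph Π k) f)
  where

  open Is3Embedding f-emb
  open IsEmbedding embedding

  module Target where
    open PolarSpace Π public
    open Polar Π public
    open WithLine L public
    open Maximal Π L public
    open Rank rank public

  open Target using (Perp)
  open PolarSpace Π′
  open Polar Π′
  open WithLine L′ hiding (Perp)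
  open Basis
  open Maximal Π′ L′
  open Rank rank′
  open Dual Π′ L′ rank′
  open MaxSub

  image : MaxSub Π′ → PolarSpace.PSet Π
  image x = KSub.carrier (f x)

  quad-image : ∀ {x} (Q : Quad x) → Perp (image (x ▹ Quad.p Q)) (image (x ▹ Quad.q Q))
  quad-image {x} Q = Target.quadrangle-perp {k} (f (x ▹ p)) (f x) (f (x ▹ p ▹ q)) (f (x ▹ q)) (f (x ▹ q ▹ v))
    room e₀₁ e₁₂ e₀₁′ e₁₂′ distinct e₂₃ far′
    where
    open Quad Q
    third = quad-far Q 2≤m
    v = proj₁ third
    Γ = GrassmannGraph Π k
    room : ¬ ¬ (Σ[ w ∈ PolarSpace.Point Π ] ((image (x ▹ p) Target.ᗮ) w × ¬ image (x ▹ p) w))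
    room = Target.basis-room (Target.kbasis (f (x ▹ p))) (≤-trans (≤-reflexive (+-comm 2 k)) k+2≤n)
    e₀₁ : Graph.Adj Γ (f (x ▹ p)) (f x)
    e₀₁ = adj→adj (x ▹ p) x (adj-comm x (x ▹ p) (adj-▹ x xt t̸p))
    e₁₂ : Graph.Adj Γ (f x) (f (x ▹ q))
    e₁₂ = adj→adj x (x ▹ q) (adj-▹ x xs s̸q)
    e₀₁′ : Graph.Adj Γ (f (x ▹ p)) (f (x ▹ p ▹ q))
    e₀₁′ = adj→adj (x ▹ p) (x ▹ p ▹ q) (adj-▹ (x ▹ p) {q} {s} (◁-⊇ (maximal x) xs s⟂p) s̸q)
    e₁₂′ : Graph.Adj Γ (f (x ▹ p ▹ q)) (f (x ▹ q))
    e₁₂′ = adj→adj (x ▹ p ▹ q) (x ▹ q) (quad-common Q)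
    distinct : ¬ (PolarSpace._≐_ Π (image x) (image (x ▹ p ▹ q)))
    distinct h = quad-x≢ Q (proj₂ (injective x (x ▹ p ▹ q) h))
    e₂₃ : Graph.Adj Γ (f (x ▹ q)) (f (x ▹ q ▹ v))
    e₂₃ = adj→adj (x ▹ q) (x ▹ q ▹ v) (proj₁ (proj₂ third))
    far′ : Target.Far (f (x ▹ p)) (f (x ▹ q ▹ v))
    far′ = proj₂ (dist-pres (x ▹ p) (x ▹ q ▹ v) 3 ≤-refl (proj₂ (proj₂ third)))

  maximal-≐ : (x y : MaxSub Π′) → carrier x ⊆ carrier y → carrier x ≐ carrier y
  maximal-≐ x y x⊆y = x⊆y , proj₂ (maximal x) (carrier y) (proj₁ (maximal y)) x⊆y

  image-self : ∀ x → Perp (image x) (image x)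
  image-self x = Target.basis-singular (Target.kbasis (f x))

  adj-image : ∀ x y → Graph.Adj (DualPolarGraph Π′ (suc m)) x y → Perp (image x) (image y)
  adj-image x y xy = Target.adj-perp {A = f x} {B = f y} (adj→adj x y xy)

  image-⊆ : {x y z : MaxSub Π′} → carrier y ⊆ carrier z → Perp (image x) (image z) → Perp (image x) (image y)
  image-⊆ {x} {y} {z} y⊆z x⟂z p q xp yq = x⟂z p q xp (proj₁ (respects y z (maximal-≐ y z y⊆z)) q yq)

  Extra : List Point → MaxSub Π′ → MaxSub Π′ → PSet
  Extra ps x y r = r ∈ ps ⊎ (carrier x r × carrier y r)

  Extra-ᗮᗮ : ∀ {ps qs} {x x′ y : MaxSub Π′} → ⟦ ps ⟧ ⊆ (Extra qs x′ y ᗮ ᗮ) →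
    (∀ r → carrier x r → carrier y r → carrier x′ r) →
    (Extra ps x y ᗮ ᗮ) ⊆ (Extra qs x′ y ᗮ ᗮ)
  Extra-ᗮᗮ {ps} {qs} {x} {x′} {y} ps⊆ xy⊆x′ = ᗮᗮ-least step
    where
    step : Extra ps x y ⊆ (Extra qs x′ y ᗮ ᗮ)
    step r (inj₁ r∈) = ps⊆ r r∈
    step r (inj₂ (xr , yr)) = ⊆ᗮᗮ {Extra qs x′ y} r (inj₂ (xy⊆x′ r xr yr , yr))

  -- A list of `i` points generating `y` together with its intersection with `x` stands for distance
  -- at most `i`, so the induction runs on lists and not on walks.
  Reach : ℕ → Set₁
  Reach i = ∀ ps x y → length ps ≡ i → ⟦ ps ⟧ ⊆ carrier y →
    carrier y ⊆ (Extra ps x y ᗮ ᗮ) → Perp (image x) (image y)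

  reach-zero : Reach 0
  reach-zero [] x y _ _ y⊆ = image-⊆ {x} {y} {x} y⊆x (image-self x)
    where
    y⊆x : carrier y ⊆ carrier x
    y⊆x q yq = maximal-closed (maximal x) q (λ r xr → y⊆ q yq r (λ { s (inj₂ (xs , _)) → msing x s r xs xr }))

  -- If y needs two points p, q besides x ∩ y, then x has the non-adjacent neighbours x ▹ p and
  -- x ▹ q, both closer to y.
  reach-suc : ∀ {i} → Reach i → Reach (suc i)
  reach-suc IH (p ∷ ps) x y eq ps⊆y y⊆ with basis? (mbasis x) p
  ... | yes xp = IH ps x y (suc-injective eq) (tail-⊆ ps⊆y)
          (λ r yr → Extra-ᗮᗮ {p ∷ ps} {ps} {x} {x} {y}
            (∷-⊆ (⊆ᗮᗮ {Extra ps x y} p (inj₂ (xp , ps⊆y p (here refl)))) (λ s s∈ → ⊆ᗮᗮ {Extra ps x y} s (inj₁ s∈)))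
            (λ _ h _ → h) r (y⊆ r yr))
  ... | no p∉x with maximal-∌ (maximal x) (mbasis x) p∉x
  reach-suc IH (p ∷ []) x y eq ps⊆y y⊆ | no p∉x | a , xa , a̸p =
    image-⊆ {x} {y} {x ▹ p} (λ q yq → ᗮᗮ-least {Extra (p ∷ []) x y} {pivot (carrier x) p} gen q (y⊆ q yq))
      (adj-image x (x ▹ p) (adj-▹ x xa a̸p))
    where
    gen : Extra (p ∷ []) x y ⊆ (carrier x ◁ p)
    gen _ (inj₁ (here refl)) = ◁-∋ (maximal x)
    gen r (inj₂ (xr , yr)) = ◁-⊇ (maximal x) xr (msing y r p yr (ps⊆y p (here refl)))
  reach-suc {i} IH (p ∷ q ∷ ps) x y eq ps⊆y y⊆ | no p∉x | a , xa , a̸p = main (p ≟ q)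
    where
    yp = ps⊆y p (here refl)
    yq = ps⊆y q (there (here refl))

    drop-q : (Extra (p ∷ ps) x y ᗮ ᗮ) q → Perp (image x) (image y)
    drop-q q∈ = IH (p ∷ ps) x y (suc-injective eq) (∷-⊆ yp (tail-⊆ (tail-⊆ ps⊆y)))
      (λ r yr → Extra-ᗮᗮ {p ∷ q ∷ ps} {p ∷ ps} {x} {x} {y}
        (∷-⊆ (⊆ᗮᗮ {Extra (p ∷ ps) x y} p (inj₁ (here refl)))
          (∷-⊆ q∈ (λ s s∈ → ⊆ᗮᗮ {Extra (p ∷ ps) x y} s (inj₁ (there s∈)))))
        (λ _ h _ → h) r (y⊆ r yr))

    -- Passing from `x` to `x ▹ v` moves `v` from the list into the intersection with `y`.
    near : ∀ v → carrier y v → ∀ qs → length qs ≡ i → ⟦ qs ⟧ ⊆ ⟦ p ∷ q ∷ ps ⟧ →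
      ⟦ p ∷ q ∷ ps ⟧ ⊆ ⟦ v ∷ qs ⟧ → Perp (image (x ▹ v)) (image y)
    near v yv qs eq′ qs⊆ ⊆qs = IH qs (x ▹ v) y eq′ (λ r r∈ → ps⊆y r (qs⊆ r r∈))
      (λ r yr → Extra-ᗮᗮ {p ∷ q ∷ ps} {qs} {x} {x ▹ v} {y}
        (λ s s∈ → ⊆ᗮᗮ {Extra qs (x ▹ v) y} s (sort s (⊆qs s s∈)))
        (λ s xs ys → ◁-⊇ (maximal x) xs (msing y s v ys yv)) r (y⊆ r yr))
      where
      sort : ∀ s → s ∈ v ∷ qs → Extra qs (x ▹ v) y s
      sort _ (here refl) = inj₂ (◁-∋ (maximal x) , yv)
      sort s (there s∈) = inj₁ s∈

    main : Dec (p ≡ q) → Perp (image x) (image y)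
    main (yes refl) = drop-q (⊆ᗮᗮ {Extra (p ∷ ps) x y} q (inj₁ (here refl)))
    -- Construction of the quadrangle. If the point `r` of `pq` collinear with `a` is in `x`, then
    -- `q` is redundant. If not, some `b` in `x` is not collinear with `r`; `s` is the point of the
    -- line `ab` collinear with `p`, and `t` the point of the line `as` collinear with `q`. Were `s`
    -- collinear with `q`, then `r` would be collinear with `s` and `a`, hence with `b`.
    main (no p≢q) with meet (msing y p q yp yq) p≢q a
    ... | r , pqr , a⟂r with basis? (mbasis x) r
    ... | yes xr = drop-q (subspace-col (ᗮ-subspace (Extra (p ∷ ps) x y ᗮ)) (λ { refl → a̸p a⟂r }) (col-swap₂₃ pqr)
            (⊆ᗮᗮ {Extra (p ∷ ps) x y} p (inj₁ (here refl)))
            (⊆ᗮᗮ {Extra (p ∷ ps) x y} r (inj₂ (xr , subspace-col (msub y) p≢q pqr yp yq))))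
    ... | no r∉x with maximal-∌ (maximal x) (mbasis x) r∉x
    ... | b , xb , b̸r with ◁-project (maximal x) xa a̸p xb (λ { refl → b̸r a⟂r })
    ... | s , xs , s⟂p , abs with meet (msing x a s xa xs) (λ { refl → a̸p s⟂p }) q
    ... | t , ast , q⟂t =
      Target.perp-through (f x) (f (x ▹ p)) (f (x ▹ q))
        (adj→adj x (x ▹ p) (adj-▹ x xt t̸p)) (adj→adj x (x ▹ q) (adj-▹ x xs s̸q))
        (λ h → quad-≢ Q (proj₁ (injective (x ▹ p) (x ▹ q) h)))
        (λ h → quad-¬adj Q (adj←adj (x ▹ p) (x ▹ q) h))
        (quad-image Q)
        (near p yp (q ∷ ps) (suc-injective eq) (λ _ → there) (λ _ h → h))
        (near q yq (p ∷ ps) (suc-injective eq)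
          (∷-⊆ (here refl) (λ _ h → there (there h)))
          (∷-⊆ (there (here refl)) (∷-⊆ (here refl) (λ _ h → there (there h)))))
      where
      a≢s : ¬ (a ≡ s)
      a≢s refl = a̸p s⟂p
      s̸q : ¬ (s ⟂ q)
      s̸q s⟂q = b̸r (⟂-sym (spread a≢s (col-swap₂₃ abs) (⟂-sym a⟂r)
                 (⟂-sym (spread p≢q pqr s⟂p s⟂q))))
      xt : carrier x t
      xt = subspace-col (msub x) a≢s ast xa xs
      t̸p : ¬ (t ⟂ p)
      t̸p t⟂p = a̸p (⟂-sym (spread (λ { refl → s̸q (⟂-sym q⟂t) }) (col-rot ast)
                 (⟂-sym s⟂p) (⟂-sym t⟂p)))
      Q : Quad x
      Q = record { p⟂q = msing y p q yp yq ; xs = xs ; xt = xt ; s⟂p = s⟂p ; s̸q = s̸q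
                 ; t⟂q = ⟂-sym q⟂t ; t̸p = t̸p }

  reach : ∀ i → Reach i
  reach zero = reach-zero
  reach (suc i) = reach-suc (reach i)

  images-perp : ∀ x y → Perp (image x) (image y)
  images-perp x y = reach _ (vectors (mbasis y)) x y refl (vectors-⊆ (mbasis y))
    (λ r yr → ᗮᗮ-mono {B = Extra (vectors (mbasis y)) x y} (λ _ → inj₁) r (proj₁ (spans (mbasis y)) r yr))

  -- The rank bound and the union of the images

  rank-bound : k + 4 ≤ n
  rank-bound = from-basis (vectors b) (length≡ b) (indep b) (vectors-⊆ b)
    where
    x : MaxSub Π′
    x = maxsub (proj₁ (proj₁ rank′)) (proj₂ (proj₁ rank′))
    b = mbasis x

    from-quad : Quad x → k + 4 ≤ n
    from-quad Q = ≤-trans (≤-reflexive (+-comm k 4)) (Target.basis-≤-rank (proj₂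
      (Target.far-span (f (x ▹ p)) (f (x ▹ q ▹ v)) (images-perp (x ▹ p) (x ▹ q ▹ v))
        (proj₂ (dist-pres (x ▹ p) (x ▹ q ▹ v) 3 ≤-refl (proj₂ (proj₂ third)))))))
      where
      open Quad Q
      third = quad-far Q 2≤m
      v = proj₁ third

    from-basis : ∀ vs → length vs ≡ suc m → Indep vs → ⟦ vs ⟧ ⊆ carrier x → k + 4 ≤ n
    from-basis [] () _ _
    from-basis (_ ∷ []) eq _ _ = ⊥-elim (m≢0 (suc-injective eq) 2≤m)
      where
      m≢0 : ∀ {i} → 0 ≡ i → ¬ (2 ≤ i)
      m≢0 refl ()
    from-basis (s ∷ t ∷ vs) _ (s∉ , _) vs⊆x =
      from-quad (quad-exists x (vs⊆x s (here refl)) (vs⊆x t (there (here refl)))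
        (λ { refl → s∉ (⟨⟩-∈ s (here refl)) }))

  -- Quantifying over all maximal singular subspaces would leave Set, so the union of the
  -- images is indexed by the point lists generating them.
  span-of : (ps : List Point) → Clique ps → IsSingular (⟦ ps ⟧ ᗮ) → MaxSub Π′
  span-of ps cl sing = maxsub (⟦ ps ⟧ ᗮ) (self-perp-maximal sing cl)

  union : PolarSpace.PSet Π
  union q = Σ[ ps ∈ List Point ] Σ[ cl ∈ Clique ps ] Σ[ sing ∈ IsSingular (⟦ ps ⟧ ᗮ) ] image (span-of ps cl sing) q

  union-singular : Target.IsSingular union
  union-singular p q (ps , cl , sing , p∈) (qs , cl′ , sing′ , q∈) =
    images-perp (span-of ps cl sing) (span-of qs cl′ sing′) p q p∈ q∈

  -- By maximality `x` is the perp of its own basis, so it agrees with an indexed vertex, and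
  -- `respects` carries this over to the images.
  image-⊆-union : ∀ x → image x Target.⊆ union
  image-⊆-union x q q∈ = vectors b , clique b , sing , proj₁ (respects x y (maximal-≐ x y x⊆y)) q q∈
    where
    b = mbasis x
    ᗮ⊆x : (⟦ vectors b ⟧ ᗮ) ⊆ carrier x
    ᗮ⊆x r r∈ = maximal-closed (maximal x) r (λ s xs → ⟨⟩-ᗮ r∈ s (proj₁ (spans b) s xs))
    sing : IsSingular (⟦ vectors b ⟧ ᗮ)
    sing p r p∈ r∈ = msing x p r (ᗮ⊆x p p∈) (ᗮ⊆x r r∈)
    y = span-of (vectors b) (clique b) sing
    x⊆y : carrier x ⊆ carrier y
    x⊆y r xr s s∈ = msing x s r (vectors-⊆ b s s∈) xr

theorem2 : (Π' Π : PolarSpace) (l n k : ℕ) →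
    HasRank Π' l → 3 ≤ l →
    HasRank Π n → k + 2 ≤ n →
    (f : Graph.V (DualPolarGraph Π' l) → Graph.V (GrassmannGraph Π k)) →
    Is3Embedding (DualPolarGraph Π' l) (GrassmannGraph Π k) f →
    (k + 4 ≤ n) ×
    (Σ[ U ∈ PolarSpace.PSet Π ] (PolarSpace.IsSingularSubspace Π U ×
    (∀ x → PolarSpace._⊆_ Π (KSub.carrier (f x)) U)))
theorem2 Π' Π (suc m) n k rank' (s≤s 2≤m) rank k+2≤n f f-emb =
  rank-bound , union ᗮ ᗮ , (ᗮ-subspace (union ᗮ) , ᗮᗮ-singular union-singular) ,
  λ x q q∈ → ⊆ᗮᗮ q (image-⊆-union x q q∈)
  where
  open Embedding Π' Π (rank-line Π' rank' (s≤s (≤-trans (s≤s z≤n) 2≤m)))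
    (rank-line Π rank (≤-trans (m≤n+m 2 k) k+2≤n)) rank' 2≤m rank k+2≤n f f-emb
  open Polar Π
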